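{- For each $\gamma \in (0,\frac{1}{2}]$ and each $0<\delta<1$, there exists a sequence $(x_n)_{n\in\mathbb{N}}$ that has weak $\gamma$-PPC (with parameter $\delta$) and is not equidistributed.
   Context: $\|\cdot\|$ denotes the distance to the nearest integer, and $\sharp$ denotes cardinality; pairs $(m,n)$ below are ordered pairs. For $\gamma\in(0,1)$ and $0<\delta<1$, a sequence $(x_n)_{n\in\mathbb{N}}$ of real numbers has weak $\gamma$-PPC (with parameter $\delta$) if for every $s>0$, $$\lim_{N\to\infty}\frac{1}{N^{2-\delta}}\,\sharp \left\{ 1 \leq m \neq n \leq N : \|x_m - x_n-\gamma\| \leq \frac{s}{N^{\delta}} \right\} =2s.$$ A real sequence $(x_n)_{n\in\mathbb{N}}$ is equidistributed (uniformly distributed modulo one) if for every interval $[a,b]\subseteq[0,1)$, $$\lim_{N \to \infty} \frac{\sharp \{1\le n\le N : x_n \bmod 1 \in [a, b]\}}{N}=b-a.$$ -}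

module Defs where

open import Algebra.Bundles using (CommutativeRing; Semiring)
import Algebra.Construct.NaturalChoice.Max as Max
import Algebra.Definitions.RawSemiring as RawSemiringDefs
open import Data.Integer.Base using (ℤ; +_; -[1+_])
open import Data.List.Base using (List; map; upTo; filter; length; cartesianProduct)
open import Data.Nat.Base using (ℕ; suc)
import Data.Nat.Base as ℕ
import Data.Nat.Properties as ℕ
open import Data.Product.Base using (_×_; _,_; ∃; ∃-syntax)
open import Level using (0ℓ)
open import Relation.Binary.Bundles using (DecTotalOrder)
open import Relation.Binary.Core using (Rel)
import Relation.Binary.Construct.NonStrictToStrict as Strict
open import Relation.Binary.Structures using (IsDecTotalOrder)
open import Relation.Nullary.Decidable using (¬?; _×-dec_)
open import Relation.Unary using (Pred; _∈_)

-- The real numbers, axiomatised (up to isomorphism) as the complete ordered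
-- field.  Three points differ from the most economical textbook axioms; all
-- hold classically for ℝ:
--   * the order is decidable, so that the cardinalities of finite sets cut
--     out by inequalities are computable natural numbers;
--   * _⁻¹ and sup are total operations, with unspecified values at 0 and at
--     sets that are empty or not bounded above, respectively;
--   * the Archimedean property, classically a consequence of completeness,
--     is listed so as to provide an actual natural number.

record CompleteOrderedField : Set₁ where
  infix  4 _≤_
  infix  9 _⁻¹

  field
    commutativeRing : CommutativeRing 0ℓ 0ℓ

  open CommutativeRing commutativeRing public
    using (Carrier; _≈_; _≉_; _+_; _*_; -_; _-_; 0#; 1#; semiring)
  open RawSemiringDefs (Semiring.rawSemiring semiring) public
    using (_^_) renaming (_×_ to _·_)

  fromℕ : ℕ → Carrier
  fromℕ n = n · 1#

  field
    _≤_             : Rel Carrier 0ℓ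
    isDecTotalOrder : IsDecTotalOrder _≈_ _≤_
    0≉1             : 0# ≉ 1#
    +-monoˡ-≤       : ∀ z {x y} → x ≤ y → x + z ≤ y + z
    *-nonNegative   : ∀ {x y} → 0# ≤ x → 0# ≤ y → 0# ≤ x * y
    _⁻¹             : Carrier → Carrier
    *-inverseʳ      : ∀ {x} → x ≉ 0# → x * x ⁻¹ ≈ 1#
    archimedean     : ∀ x → ∃[ n ] x ≤ fromℕ n

  UpperBound : Pred Carrier 0ℓ → Carrier → Set
  UpperBound S u = ∀ {x} → x ∈ S → x ≤ u

  IsLub : Pred Carrier 0ℓ → Carrier → Set
  IsLub S u = UpperBound S u × (∀ {v} → UpperBound S v → u ≤ v)

  field
    sup       : Pred Carrier 0ℓ → Carrier
    sup-isLub : ∀ S → ∃ S → ∃ (UpperBound S) → IsLub S (sup S)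

  open Strict _≈_ _≤_ public using (_<_)

  decTotalOrder : DecTotalOrder 0ℓ 0ℓ 0ℓ
  decTotalOrder = record { isDecTotalOrder = isDecTotalOrder }

  open DecTotalOrder decTotalOrder public using (_≤?_; totalOrder)
  open Max totalOrder public using (_⊔_)

module RealAnalysis (ℝ : CompleteOrderedField) where

  open CompleteOrderedField ℝ public

  infixl 7 _/_
  _/_ : Carrier → Carrier → Carrier
  x / y = x * y ⁻¹

  ∣_∣ : Carrier → Carrier
  ∣ x ∣ = x ⊔ (- x)

  fromℤ : ℤ → Carrier
  fromℤ (+ n)    = fromℕ n
  fromℤ -[1+ n ] = - fromℕ (suc n)

  inf : Pred Carrier 0ℓ → Carrier
  inf S = - sup (λ y → (- y) ∈ S)

  ⌊_⌋ : Carrier → Carrier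
  ⌊ x ⌋ = sup λ y → ∃[ k ] (y ≈ fromℤ k × fromℤ k ≤ x)

  _mod1 : Carrier → Carrier
  x mod1 = x - ⌊ x ⌋

  ‖_‖ : Carrier → Carrier
  ‖ x ‖ = inf λ y → ∃[ k ] y ≈ ∣ x - fromℤ k ∣

  -- For b ≥ 1 and e ≥ 0 (the only case used), the real power
  -- b ^ e = sup { b ^ (p/q) : p/q ∈ ℚ, 0 ≤ p/q ≤ e }, with each b ^ (p/q)
  -- replaced by the interval [0 , b ^ (p/q)] = { y ≥ 0 : y ^ q ≤ b ^ p },
  -- where q = suc r.
  infixr 8 _^ʳ_
  _^ʳ_ : Carrier → Carrier → Carrier
  b ^ʳ e = sup λ y → 0# ≤ y ×
    (∃[ p ] ∃[ r ] (fromℕ p / fromℕ (suc r) ≤ e × y ^ suc r ≤ b ^ p))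

  TendsTo : (ℕ → Carrier) → Carrier → Set
  TendsTo a l =
    ∀ ε → 0# < ε → ∃[ N₀ ] ∀ N → N₀ ℕ.≤ N → ∣ a N - l ∣ < ε

  -- Sequences are indexed from 1: the value at 0 is never consulted.
  indices : ℕ → List ℕ
  indices N = map suc (upTo N)

  pairCount : Carrier → Carrier → Carrier → (ℕ → Carrier) → ℕ → ℕ
  pairCount γ δ s x N = length (filter
    (λ (m , n) → ¬? (m ℕ.≟ n) ×-dec (‖ x m - x n - γ ‖ ≤? s / fromℕ N ^ʳ δ))
    (cartesianProduct (indices N) (indices N)))

  WeakPPC : Carrier → Carrier → (ℕ → Carrier) → Set
  WeakPPC γ δ x = ∀ s → 0# < s →
    TendsTo
      (λ N → 1# / fromℕ N ^ʳ (fromℕ 2 - δ) * fromℕ (pairCount γ δ s x N))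
      (fromℕ 2 * s)

  visitCount : Carrier → Carrier → (ℕ → Carrier) → ℕ → ℕ
  visitCount a b x N = length (filter
    (λ n → (a ≤? x n mod1) ×-dec (x n mod1 ≤? b))
    (indices N))

  Equidistributed : (ℕ → Carrier) → Set
  Equidistributed x = ∀ a b → 0# ≤ a → a ≤ b → b < 1# →
    TendsTo (λ N → fromℕ (visitCount a b x N) / fromℕ N) (b - a)

module Submission where

-- Let y be the van der Corput sequence, put a = γ/2, and let x be y with all
-- terms in [0, a] moved to 0.  No term of x falls into [a/2, a], so x is not
-- equidistributed.  Write h(t) = 1 if ‖t‖ ≤ ε and h(t) = 0 otherwise, where
-- ε = s/N^δ < a.  Points of [0, a] are never at distance about γ from each
-- other, so checking which of xₘ and xₙ have been moved gives
--   h(xₘ - xₙ - γ) + h(yₘ - yₙ - γ) = h(yₘ - xₙ - γ) + h(xₘ - yₙ - γ).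
-- Every term but the first involves y, and the discrepancy of y makes the sum
-- of each of these over m, n ≤ N equal to 2εN² + O(N log N).  Hence so is the
-- pair count of x, and N log N = o(N^(2-δ)).
--
-- The indicator is h(t) = ⌊ε + t⌋ + ⌊ε + (1 - t)⌋, so the discrepancy bound
-- reduces to |∑_{n<N} ⌊t + yₙ⌋ - N t| = O(log N), which follows from Hermite's
-- identity ⌊z⌋ + ⌊z + ½⌋ = ⌊2z⌋ by halving N.

open import Defs
open import Algebra.Bundles using (CommutativeRing)
import Algebra.Construct.NaturalChoice.Max as Max
import Algebra.Properties.CommutativeMonoid.Sum as CommutativeMonoidSum
import Algebra.Properties.CommutativeSemiring.Exp as CommutativeSemiringExp
import Algebra.Properties.Ring as RingProperties
import Algebra.Properties.Semiring.Mult as SemiringMult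
import Algebra.Solver.Ring as RingSolver
open import Algebra.Solver.Ring.AlmostCommutativeRing
  using (fromCommutativeRing; _-Raw-AlmostCommutative⟶_)
open import Data.Fin.Base using (toℕ)
open import Data.Integer.Base as ℤ using (+_; -[1+_])
import Data.Integer.Properties as ℤ
open import Data.List.Base
  using (List; []; _∷_; _++_; map; foldr; filter; length; applyUpTo; upTo; cartesianProduct)
import Data.List.Properties as List
import Data.List.Relation.Unary.All as All
import Data.Maybe.Base as Maybe
open import Data.Nat.Base as ℕ using (ℕ; zero; suc; z≤n; s≤s)
open import Data.Nat.Binary.Base as ℕᵇ using (ℕᵇ; zero; 2[1+_]; 1+[2_])
import Data.Nat.Binary.Properties as ℕᵇ
import Data.Nat.DivMod as ℕ
import Data.Nat.Properties as ℕ
open import Data.Product.Base using (_×_; _,_; proj₁; proj₂; ∃-syntax)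
open import Data.Sum.Base using (_⊎_; inj₁; inj₂)
open import Function.Base using (_∘_)
open import Level using (0ℓ)
open import Relation.Binary.Bundles using (DecTotalOrder)
import Relation.Binary.Construct.NonStrictToStrict as Strict
import Relation.Binary.Properties.DecTotalOrder as DecTotalOrderProperties
open import Relation.Binary.PropositionalEquality.Core as ≡ using (_≡_)
import Relation.Binary.Reasoning.PartialOrder as PartialOrderReasoning
open import Relation.Nullary.Decidable.Core using (yes; no; dec⇒maybe)
open import Relation.Nullary.Negation.Core using (¬_; contradiction)
open import Relation.Unary using (Pred; Decidable; _∈_)

-- The pair count is bilinear in the counting measure of the sequence. Moving the terms changes that
-- measure by a signed measure carried by [0, a], whose correlations with itself occur at
-- differences of size at most a, away from γ = 2a; this is the origin of the exchange identity.
-- After subtracting γ these differences lie in [-3a, -a], and 4a = 2γ ≤ 1 keeps that range at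
-- distance at least a from every integer, which is how γ ≤ ½ enters. For the same reason the
-- diagonal m = n contributes nothing, so it may stay in the sums.
--
-- The floor form of the indicator is valid for every real t, so windows may be centred anywhere
-- without being cut modulo one, and the resulting error bound is uniform in ε. This uniformity
-- matters because ε shrinks with N. Relative to N^(2-δ) the error is of order log N / N^(1-δ),
-- which vanishes in the limit since δ < 1.

-- Logarithmic growth of the number of binary digits.

module BinarySize where

  open import Data.Nat.Base using (_+_; _*_; _^_; _≤_; _<_; _/_; _%_; NonZero)
  open ℕ.≤-Reasoning

  -- This is the logarithm of the error term. It counts digits in bijective base 2, the numeration
  -- on which the discrepancy induction recurses.
  binarySize : ℕ → ℕ
  binarySize N = ℕᵇ.size (ℕᵇ.fromℕ N)

  *-distrib-^ : ∀ m n k → (m * n) ^ k ≡ m ^ k * n ^ k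
  *-distrib-^ m n zero    = ≡.refl
  *-distrib-^ m n (suc k) = ≡.trans (≡.cong (m * n *_) (*-distrib-^ m n k))
      (ℕ.[m*n]*[o*p]≡[m*o]*[n*p] m n (m ^ k) (n ^ k))

  1+n≤2^n : ∀ n → suc n ≤ 2 ^ n
  1+n≤2^n zero    = s≤s z≤n
  1+n≤2^n (suc n) = ℕ.≤-trans (ℕ.+-mono-≤ (ℕ.m^n>0 2 n) (1+n≤2^n n)) (ℕ.≤-reflexive (≡.cong (λ k →
      2 ^ n + k) (≡.sym (ℕ.+-identityʳ (2 ^ n)))))

  -- The least numeral with k digits is 1...1, of value 2^k - 1.
  2^size≤1+toℕ : ∀ b → 2 ^ ℕᵇ.size b ≤ suc (ℕᵇ.toℕ b)
  2^size≤1+toℕ zero     = s≤s z≤n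
  2^size≤1+toℕ 2[1+ b ] = ℕ.≤-trans (ℕ.*-monoʳ-≤ 2 (2^size≤1+toℕ b)) (ℕ.n≤1+n _)
  2^size≤1+toℕ 1+[2 b ] = ℕ.≤-trans (ℕ.*-monoʳ-≤ 2 (2^size≤1+toℕ b)) (ℕ.≤-reflexive (ℕ.*-suc 2
      (ℕᵇ.toℕ b)))

  -- Exponential beats polynomial, with an explicit constant: the linear bound k ≤ p * 2^(k/p), with
  -- integer quotient, is raised to the power p.
  k^p≤p^p*2^k : ∀ p .{{_ : NonZero p}} k → k ^ p ≤ p ^ p * 2 ^ k
  k^p≤p^p*2^k p k = begin
    k ^ p                        ≤⟨ ℕ.^-monoˡ-≤ p k≤p*2^[k/p] ⟩
    (p * 2 ^ (k / p)) ^ p        ≡⟨ *-distrib-^ p (2 ^ (k / p)) p ⟩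
    p ^ p * (2 ^ (k / p)) ^ p    ≡⟨ ≡.cong (p ^ p *_) (ℕ.^-*-assoc 2 (k / p) p) ⟩
    p ^ p * 2 ^ (k / p * p)      ≤⟨ ℕ.*-monoʳ-≤ (p ^ p) (ℕ.^-monoʳ-≤ 2 (ℕ.m/n*n≤m k p)) ⟩
    p ^ p * 2 ^ k                ∎
    where
    k≤p*2^[k/p] : k ≤ p * 2 ^ (k / p)
    k≤p*2^[k/p] = begin
      k                    ≡⟨ ℕ.m≡m%n+[m/n]*n k p ⟩
      k % p + k / p * p    ≤⟨ ℕ.+-monoˡ-≤ _ (ℕ.<⇒≤ (ℕ.m%n<n k p)) ⟩
      suc (k / p) * p      ≤⟨ ℕ.*-monoˡ-≤ p (1+n≤2^n (k / p)) ⟩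
      2 ^ (k / p) * p      ≡⟨ ℕ.*-comm _ p ⟩
      p * 2 ^ (k / p)      ∎

  -- If N has at most `M` digits, the choice of N₀ suffices. If it has k > `M` digits, the extra
  -- factor k in k^(q+1) pays for both 2 * K^q and `C`, so twice the left side is at most N + 1. The
  -- summand 2 in N₀ then excludes 2N ≤ N + 1.
  [K*binarySize]^q<N : ∀ K q → ∃[ N₀ ] ∀ N → N₀ ≤ N → (K * binarySize N) ^ q < N
  [K*binarySize]^q<N K q = 2 + (K * M) ^ q , below
    where
    C M : ℕ
    C = suc q ^ suc q
    M = 2 * K ^ q * C
    below : ∀ N → 2 + (K * M) ^ q ≤ N → (K * binarySize N) ^ q < N
    below N N₀≤N with binarySize N ℕ.≤? M
    ... | yes k≤M = ℕ.≤-trans (s≤s (ℕ.≤-trans (ℕ.^-monoˡ-≤ q (ℕ.*-monoʳ-≤ K k≤M)) (ℕ.n≤1+n _))) N₀≤N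
    ... | no  k≰M = ℕ.≰⇒> λ N≤X → ℕ.<⇒≱ (ℕ.≤-trans (s≤s (s≤s z≤n)) N₀≤N)
        (ℕ.+-cancelˡ-≤ N N 1 (begin
          N + N         ≡⟨ ≡.cong (λ k → N + k) (≡.sym (ℕ.+-identityʳ N)) ⟩
          2 * N         ≤⟨ ℕ.*-monoʳ-≤ 2 N≤X ⟩
          2 * (K * k) ^ q  ≤⟨ 2X≤1+N ⟩
          suc N         ≡⟨ ℕ.+-comm 1 N ⟩
          N + 1         ∎))
      where
      k = binarySize N
      2X≤1+N : 2 * (K * k) ^ q ≤ suc N
      2X≤1+N = ℕ.*-cancelˡ-≤ C {{ℕ.m^n≢0 (suc q) (suc q)}} (begin
        C * (2 * (K * k) ^ q)        ≡⟨ ≡.cong (λ x → C * (2 * x)) (*-distrib-^ K k q) ⟩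
        C * (2 * (K ^ q * k ^ q))    ≡⟨ ≡.cong (C *_) (≡.sym (ℕ.*-assoc 2 (K ^ q) (k ^ q))) ⟩
        C * (2 * K ^ q * k ^ q)      ≡⟨ ≡.sym (ℕ.*-assoc C (2 * K ^ q) (k ^ q)) ⟩
        C * (2 * K ^ q) * k ^ q      ≡⟨ ≡.cong (_* k ^ q) (ℕ.*-comm C (2 * K ^ q)) ⟩
        M * k ^ q                    ≤⟨ ℕ.*-monoˡ-≤ (k ^ q) (ℕ.<⇒≤ (ℕ.≰⇒> k≰M)) ⟩
        k ^ suc q                    ≤⟨ k^p≤p^p*2^k (suc q) k ⟩
        C * 2 ^ k                    ≤⟨ ℕ.*-monoʳ-≤ C (2^size≤1+toℕ (ℕᵇ.fromℕ N)) ⟩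
        C * suc (ℕᵇ.toℕ (ℕᵇ.fromℕ N)) ≡⟨ ≡.cong (λ x → C * suc x) (ℕᵇ.toℕ-fromℕ N) ⟩
        C * suc N                    ∎)

-- Arithmetic and inequalities in an ordered field.

module OrderedField (ℝ : CompleteOrderedField) where

  open RealAnalysis ℝ
  open CommutativeRing commutativeRing public
    using ( refl; sym; trans; reflexive; ring; commutativeSemiring
          ; +-cong; +-congˡ; +-congʳ; +-assoc; +-comm; +-identityˡ; +-identityʳ
          ; -‿cong; -‿inverseʳ; +-commutativeMonoid
          ; *-cong; *-congˡ; *-congʳ; *-assoc; *-comm; *-identityˡ; *-identityʳ
          ; distribˡ; distribʳ; zeroˡ; zeroʳ )
  open DecTotalOrder decTotalOrder public using (poset; ≤-respˡ-≈; ≤-respʳ-≈)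
    renaming ( refl to ≤-refl; trans to ≤-trans; antisym to ≤-antisym
             ; reflexive to ≤-reflexive; total to ≤-total
             )
  open DecTotalOrderProperties decTotalOrder public
    using (<⇒≱; ≰⇒>; ≮⇒≥; <-trans; <-respˡ-≈; <-respʳ-≈)
  open RingProperties ring public using (-0#≈0#; -‿+-comm; -‿involutive; -‿distribˡ-*; -‿distribʳ-*)
  open SemiringMult semiring public using (×1-homo-*) renaming (×-homo-+ to ·-homo-+)
  open CommutativeSemiringExp commutativeSemiring public
    using (^-congˡ; ^-congʳ; ^-homo-*; ^-assocʳ; ^-distrib-*)
  open Max totalOrder public using (⊔-sel; x≤x⊔y; x≤y⊔x; ⊔-lub)
  module ≤-Reasoning = PartialOrderReasoning poset

  private variable
    w x y z : Carrier

  <⇒≤ : x < y → x ≤ y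
  <⇒≤ = proj₁

  <-≤-trans : x < y → y ≤ z → x < z
  <-≤-trans = Strict.<-≤-trans _≈_ _≤_ sym ≤-trans ≤-antisym ≤-respʳ-≈

  ≤-<-trans : x ≤ y → y < z → x < z
  ≤-<-trans = Strict.≤-<-trans _≈_ _≤_ ≤-trans ≤-antisym ≤-respˡ-≈

  fromℤ-⊖ : ∀ m n → fromℤ (m ℤ.⊖ n) ≈ fromℕ m - fromℕ n
  fromℤ-⊖ m       zero    = sym (trans (+-congˡ -0#≈0#) (+-identityʳ _))
  fromℤ-⊖ zero    (suc n) = sym (+-identityˡ _)
  fromℤ-⊖ (suc m) (suc n) = begin-equality
    fromℤ (suc m ℤ.⊖ suc n)                  ≡⟨ ≡.cong fromℤ (ℤ.[1+m]⊖[1+n]≡m⊖n m n) ⟩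
    fromℤ (m ℤ.⊖ n)                          ≈⟨ fromℤ-⊖ m n ⟩
    fromℕ m - fromℕ n                        ≈⟨ +-congʳ (+-identityʳ _) ⟨
    fromℕ m + 0# - fromℕ n                   ≈⟨ +-congʳ (+-congˡ (-‿inverseʳ 1#)) ⟨
    fromℕ m + (1# - 1#) - fromℕ n            ≈⟨ +-congʳ (+-assoc _ _ _) ⟨
    fromℕ m + 1# - 1# - fromℕ n              ≈⟨ +-congʳ (+-congʳ (+-comm _ _)) ⟩
    fromℕ (suc m) - 1# - fromℕ n             ≈⟨ +-assoc _ _ _ ⟩
    fromℕ (suc m) + (- 1# - fromℕ n)         ≈⟨ +-congˡ (-‿+-comm _ _) ⟩
    fromℕ (suc m) - fromℕ (suc n)            ∎
    where open ≤-Reasoning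

  fromℕ-+ : ∀ m n → fromℕ (m ℕ.+ n) ≈ fromℕ m + fromℕ n
  fromℕ-+ = ·-homo-+ 1#

  fromℕ-* : ∀ m n → fromℕ (m ℕ.* n) ≈ fromℕ m * fromℕ n
  fromℕ-* = ×1-homo-*

  fromℤ-+ : ∀ i j → fromℤ (i ℤ.+ j) ≈ fromℤ i + fromℤ j
  fromℤ-+ (+ m)    (+ n)    = fromℕ-+ m n
  fromℤ-+ (+ m)    -[1+ n ] = fromℤ-⊖ m (suc n)
  fromℤ-+ -[1+ m ] (+ n)    = trans (fromℤ-⊖ n (suc m)) (+-comm _ _)
  fromℤ-+ -[1+ m ] -[1+ n ] = begin-equality
    - fromℕ (suc (suc (m ℕ.+ n)))     ≡⟨ ≡.cong (λ k → - fromℕ (suc k)) (ℕ.+-suc m n) ⟨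
    - fromℕ (suc m ℕ.+ suc n)         ≈⟨ -‿cong (fromℕ-+ (suc m) (suc n)) ⟩
    - (fromℕ (suc m) + fromℕ (suc n)) ≈⟨ -‿+-comm _ _ ⟨
    - fromℕ (suc m) - fromℕ (suc n)   ∎
    where open ≤-Reasoning

  fromℤ-neg : ∀ i → fromℤ (ℤ.- i) ≈ - fromℤ i
  fromℤ-neg (+ zero)  = sym -0#≈0#
  fromℤ-neg (+ suc n) = refl
  fromℤ-neg -[1+ n ]  = sym (-‿involutive _)

  fromℤ-* : ∀ i j → fromℤ (i ℤ.* j) ≈ fromℤ i * fromℤ j
  fromℤ-* (+ m) (+ n) = trans (reflexive (≡.cong fromℤ (≡.sym (ℤ.pos-* m n)))) (fromℕ-* m n)
  fromℤ-* -[1+ m ] j = begin-equality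
    fromℤ (ℤ.- (+ suc m) ℤ.* j)   ≡⟨ ≡.cong fromℤ (ℤ.neg-distribˡ-* (+ suc m) j) ⟨
    fromℤ (ℤ.- (+ suc m ℤ.* j))   ≈⟨ fromℤ-neg (+ suc m ℤ.* j) ⟩
    - fromℤ (+ suc m ℤ.* j)       ≈⟨ -‿cong (helper j) ⟩
    - (fromℕ (suc m) * fromℤ j)   ≈⟨ -‿distribˡ-* _ _ ⟩
    - fromℕ (suc m) * fromℤ j     ∎
    where
    open ≤-Reasoning
    helper : ∀ j → fromℤ (+ suc m ℤ.* j) ≈ fromℕ (suc m) * fromℤ j
    helper (+ n) = trans (reflexive (≡.cong fromℤ (≡.sym (ℤ.pos-* (suc m) n)))) (fromℕ-* (suc m) n)
    helper -[1+ n ] = begin-equality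
      fromℤ (+ suc m ℤ.* -[1+ n ])       ≡⟨ ≡.cong fromℤ (ℤ.neg-distribʳ-* (+ suc m) (+ suc n)) ⟨
      fromℤ (ℤ.- (+ suc m ℤ.* + suc n))  ≈⟨ fromℤ-neg (+ suc m ℤ.* + suc n) ⟩
      - fromℤ (+ suc m ℤ.* + suc n)      ≈⟨ -‿cong (helper (+ suc n)) ⟩
      - (fromℕ (suc m) * fromℕ (suc n))  ≈⟨ -‿distribʳ-* _ _ ⟩
      fromℕ (suc m) * - fromℕ (suc n)    ∎
  fromℤ-* (+ m) -[1+ n ] = begin-equality
    fromℤ (+ m ℤ.* -[1+ n ])       ≡⟨ ≡.cong fromℤ (ℤ.neg-distribʳ-* (+ m) (+ suc n)) ⟨
    fromℤ (ℤ.- (+ m ℤ.* + suc n))  ≈⟨ fromℤ-neg (+ m ℤ.* + suc n) ⟩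
    - fromℤ (+ m ℤ.* + suc n)
        ≈⟨ -‿cong (trans (reflexive (≡.cong fromℤ (≡.sym (ℤ.pos-* m (suc n))))) (fromℕ-* m
        (suc n))) ⟩
    - (fromℕ m * fromℕ (suc n))    ≈⟨ -‿distribʳ-* _ _ ⟩
    fromℕ m * - fromℕ (suc n)      ∎
    where open ≤-Reasoning

  -- Integer coefficients for the ring solver. The numeral `con (+ 1)` denotes `1# + 0#` rather than
  -- `1#`, which is why `1#` is usually passed to the solver as a variable o.
  fromℤ-homomorphism : CommutativeRing.rawRing ℤ.+-*-commutativeRing
                       -Raw-AlmostCommutative⟶ fromCommutativeRing commutativeRing
  fromℤ-homomorphism = record
    { ⟦_⟧ = fromℤ
    ; +-homo = fromℤ-+
    ; *-homo = fromℤ-*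
    ; -‿homo = fromℤ-neg
    ; 0-homo = refl
    ; 1-homo = +-identityʳ 1#
    }

  open RingSolver (CommutativeRing.rawRing ℤ.+-*-commutativeRing)
    (fromCommutativeRing commutativeRing) fromℤ-homomorphism
    (λ i j → Maybe.map (reflexive ∘ ≡.cong fromℤ) (dec⇒maybe (i ℤ.≟ j))) public
    using (solve; _:=_; _:+_; _:-_; _:*_; :-_; con)

  infixr 6 _⊕_ _<⊕_ _⊕<_

  _⊕_ : w ≤ x → y ≤ z → w + y ≤ x + z
  _⊕_ {w} {x} {y} {z} w≤x y≤z = begin
    w + y ≤⟨ +-monoˡ-≤ y w≤x ⟩
    x + y ≈⟨ +-comm _ _ ⟩
    y + x ≤⟨ +-monoˡ-≤ x y≤z ⟩
    z + x ≈⟨ +-comm _ _ ⟩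
    x + z ∎
    where open ≤-Reasoning

  +-cancelʳ-≤ : ∀ z → x + z ≤ y + z → x ≤ y
  +-cancelʳ-≤ {x} {y} z x+z≤y+z = begin
    x           ≈⟨ solve 2 (λ x z → x := x :+ z :- z) refl x z ⟩
    x + z - z   ≤⟨ +-monoˡ-≤ (- z) x+z≤y+z ⟩
    y + z - z   ≈⟨ solve 2 (λ y z → y :+ z :- z := y) refl y z ⟩
    y           ∎
    where open ≤-Reasoning

  +-monoˡ-< : ∀ z → x < y → x + z < y + z
  +-monoˡ-< z x<y = ≰⇒> λ y+z≤x+z → <⇒≱ x<y (+-cancelʳ-≤ z y+z≤x+z)

  _<⊕_ : w < x → y ≤ z → w + y < x + z
  w<x <⊕ y≤z = <-≤-trans (+-monoˡ-< _ w<x) (≤-refl ⊕ y≤z)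

  _⊕<_ : w ≤ x → y < z → w + y < x + z
  w≤x ⊕< y<z = <-respˡ-≈ (+-comm _ _) (<-respʳ-≈ (+-comm _ _) (y<z <⊕ w≤x))

  -- Linear arithmetic: x ≤ y (or x < y) holds as soon as y - x is the
  -- difference z - w of a known inequality, usually a sum formed by _⊕_.
  linear≤ : w ≤ z → w + y ≈ z + x → x ≤ y
  linear≤ {w} {z} {y} {x} w≤z eq = +-cancelʳ-≤ z (begin
    x + z ≈⟨ +-comm _ _ ⟩
    z + x ≈⟨ eq ⟨
    w + y ≤⟨ +-monoˡ-≤ y w≤z ⟩
    z + y ≈⟨ +-comm _ _ ⟩
    y + z ∎)
    where open ≤-Reasoning

  linear< : w < z → w + y ≈ z + x → x < y
  linear< w<z eq = ≰⇒> λ y≤x →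
    <⇒≱ (w<z <⊕ y≤x) (≤-reflexive (sym eq))

  *-monoˡ-≤ : 0# ≤ z → x ≤ y → z * x ≤ z * y
  *-monoˡ-≤ {z} {x} {y} 0≤z x≤y = linear≤
    (*-nonNegative 0≤z (linear≤ {y = y - x} x≤y (solve 2 (λ x y → x :+ (y :- x)
        := y :+ con (+ 0)) refl x y)))
    (solve 3 (λ x y z → con (+ 0) :+ z :* y := z :* (y :- x) :+ z :* x) refl x y z)

  *-monoʳ-≤ : 0# ≤ z → x ≤ y → x * z ≤ y * z
  *-monoʳ-≤ 0≤z x≤y = ≤-respˡ-≈ (*-comm _ _) (≤-respʳ-≈ (*-comm _ _) (*-monoˡ-≤ 0≤z x≤y))

  *-mono-≤ : 0# ≤ w → w ≤ x → 0# ≤ y → y ≤ z → w * y ≤ x * z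
  *-mono-≤ 0≤w w≤x 0≤y y≤z = ≤-trans (*-monoʳ-≤ 0≤y w≤x) (*-monoˡ-≤ (≤-trans 0≤w w≤x) y≤z)

  x⁻¹x≈1 : 0# < x → x ⁻¹ * x ≈ 1#
  x⁻¹x≈1 (_ , 0≉x) = trans (*-comm _ _) (*-inverseʳ (0≉x ∘ sym))

  /-*-cancel : 0# < y → x / y * y ≈ x
  /-*-cancel {y} {x} 0<y = trans (*-assoc _ _ _) (trans (*-congˡ (x⁻¹x≈1 0<y)) (*-identityʳ x))

  0≤1 : 0# ≤ 1#
  0≤1 with ≤-total 0# 1#
  ... | inj₁ 0≤1 = 0≤1
  ... | inj₂ 1≤0 = ≤-respʳ-≈ (trans (solve 1 (λ x → (:- x) :* (:- x) := x :* x)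
      refl 1#) (*-identityˡ 1#)) (*-nonNegative 0≤-1 0≤-1)
    where
    0≤-1 : 0# ≤ - 1#
    0≤-1 = linear≤ 1≤0 (solve 1 (λ x → x :+ (:- x) := con (+ 0) :+ con (+ 0)) refl 1#)

  0<1 : 0# < 1#
  0<1 = 0≤1 , 0≉1

  *-positive : 0# < x → 0# < y → 0# < x * y
  *-positive {x} {y} 0<x 0<y = *-nonNegative (<⇒≤ 0<x) (<⇒≤ 0<y) , λ 0≈xy →
    proj₂ 0<x (begin-equality
      0#              ≈⟨ zeroʳ (y ⁻¹) ⟨
      y ⁻¹ * 0#       ≈⟨ *-congˡ 0≈xy ⟩
      y ⁻¹ * (x * y)  ≈⟨ solve 3 (λ x y z → z :* (x :* y) := x :* (z :* y)) refl x y (y ⁻¹) ⟩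
      x * (y ⁻¹ * y)  ≈⟨ *-congˡ (x⁻¹x≈1 0<y) ⟩
      x * 1#          ≈⟨ *-identityʳ x ⟩
      x               ∎)
    where open ≤-Reasoning

  *-monoʳ-< : 0# < z → x < y → x * z < y * z
  *-monoʳ-< {z} {x} {y} 0<z x<y = linear<
    (*-positive 0<z (linear< {y = y - x} x<y (solve 2 (λ x y → x :+ (y :- x)
        := y :+ con (+ 0)) refl x y)))
    (solve 3 (λ x y z → con (+ 0) :+ y :* z := z :* (y :- x) :+ x :* z) refl x y z)

  *-cancelʳ-≤ : 0# < z → x * z ≤ y * z → x ≤ y
  *-cancelʳ-≤ 0<z xz≤yz = ≮⇒≥ λ y<x → <⇒≱ (*-monoʳ-< 0<z y<x) xz≤yz

  *-cancelʳ-< : 0# ≤ z → x * z < y * z → x < y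
  *-cancelʳ-< 0≤z xz<yz = ≰⇒> λ y≤x → <⇒≱ xz<yz (*-monoʳ-≤ 0≤z y≤x)

  /-positive : 0# < x → 0# < y → 0# < x / y
  /-positive {x} {y} 0<x 0<y = *-cancelʳ-< (<⇒≤ 0<y)
    (<-respˡ-≈ (sym (zeroˡ y)) (<-respʳ-≈ (sym (/-*-cancel 0<y)) 0<x))

  x≤y/z : 0# < z → x * z ≤ y → x ≤ y / z
  x≤y/z 0<z xz≤y = *-cancelʳ-≤ 0<z (≤-respʳ-≈ (sym (/-*-cancel 0<z)) xz≤y)

  x/z≤y : 0# < z → x ≤ y * z → x / z ≤ y
  x/z≤y 0<z x≤yz = *-cancelʳ-≤ 0<z (≤-respˡ-≈ (sym (/-*-cancel 0<z)) x≤yz)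

  x/z≤y⇒x≤yz : 0# < z → x / z ≤ y → x ≤ y * z
  x/z≤y⇒x≤yz 0<z x/z≤y = ≤-respˡ-≈ (/-*-cancel 0<z) (*-monoʳ-≤ (<⇒≤ 0<z) x/z≤y)

  x/z<y : 0# < z → x < y * z → x / z < y
  x/z<y 0<z x<yz = *-cancelʳ-< (<⇒≤ 0<z) (<-respˡ-≈ (sym (/-*-cancel 0<z)) x<yz)

  fromℕ-nonNegative : ∀ n → 0# ≤ fromℕ n
  fromℕ-nonNegative zero    = ≤-refl
  fromℕ-nonNegative (suc n) = ≤-respˡ-≈ (+-identityˡ 0#) (0≤1 ⊕ fromℕ-nonNegative n)

  fromℕ-mono-≤ : ∀ {m n} → m ℕ.≤ n → fromℕ m ≤ fromℕ n
  fromℕ-mono-≤ {n = n} z≤n = fromℕ-nonNegative n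
  fromℕ-mono-≤ (s≤s m≤n)   = ≤-refl ⊕ fromℕ-mono-≤ m≤n

  1≤fromℕ : ∀ {n} → 1 ℕ.≤ n → 1# ≤ fromℕ n
  1≤fromℕ 1≤n = ≤-respˡ-≈ (+-identityʳ 1#) (fromℕ-mono-≤ 1≤n)

  fromℕ-positive : ∀ {n} → 1 ℕ.≤ n → 0# < fromℕ n
  fromℕ-positive 1≤n = <-≤-trans 0<1 (1≤fromℕ 1≤n)

  fromℕ-mono-< : ∀ {m n} → m ℕ.< n → fromℕ m < fromℕ n
  fromℕ-mono-< {m} m<n = <-≤-trans
    (linear< 0<1 (solve 2 (λ m o → con (+ 0) :+ (o :+ m) := o :+ m)
        refl (fromℕ m) 1#)) (fromℕ-mono-≤ m<n)

  fromℕ-cancel-≤ : ∀ {m n} → fromℕ m ≤ fromℕ n → m ℕ.≤ n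
  fromℕ-cancel-≤ m≤n = ℕ.≮⇒≥ λ n<m → <⇒≱ (fromℕ-mono-< n<m) m≤n

  fromℕ-cancel-< : ∀ {m n} → fromℕ m < fromℕ n → m ℕ.< n
  fromℕ-cancel-< m<n = ℕ.≰⇒> λ n≤m → <⇒≱ m<n (fromℕ-mono-≤ n≤m)

  fromℕ-^ : ∀ m n → fromℕ (m ℕ.^ n) ≈ fromℕ m ^ n
  fromℕ-^ m zero    = +-identityʳ 1#
  fromℕ-^ m (suc n) = trans (fromℕ-* m (m ℕ.^ n)) (*-congˡ (fromℕ-^ m n))

  ^-nonNegative : ∀ n → 0# ≤ x → 0# ≤ x ^ n
  ^-nonNegative zero    _   = 0≤1
  ^-nonNegative (suc n) 0≤x = *-nonNegative 0≤x (^-nonNegative n 0≤x)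

  ^-positive : ∀ n → 0# < x → 0# < x ^ n
  ^-positive zero    _   = 0<1
  ^-positive (suc n) 0<x = *-positive 0<x (^-positive n 0<x)

  ^-monoˡ-≤ : ∀ n → 0# ≤ x → x ≤ y → x ^ n ≤ y ^ n
  ^-monoˡ-≤ zero    _   _   = ≤-refl
  ^-monoˡ-≤ (suc n) 0≤x x≤y = *-mono-≤ 0≤x x≤y (^-nonNegative n 0≤x) (^-monoˡ-≤ n 0≤x x≤y)

  1^n≈1 : ∀ n → 1# ^ n ≈ 1#
  1^n≈1 zero    = refl
  1^n≈1 (suc n) = trans (*-identityˡ _) (1^n≈1 n)

  ^-monoʳ-≤ : ∀ {m n} → 1# ≤ x → m ℕ.≤ n → x ^ m ≤ x ^ n
  ^-monoʳ-≤ {n = n} 1≤x z≤n = ≤-respˡ-≈ (1^n≈1 n) (^-monoˡ-≤ n 0≤1 1≤x)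
  ^-monoʳ-≤ 1≤x (s≤s m≤n)   = *-monoˡ-≤ (≤-trans 0≤1 1≤x) (^-monoʳ-≤ 1≤x m≤n)

  ^-cancel-< : ∀ n → 0# ≤ y → x ^ n < y ^ n → x < y
  ^-cancel-< n 0≤y x^n<y^n = ≰⇒> λ y≤x → <⇒≱ x^n<y^n (^-monoˡ-≤ n 0≤y y≤x)

  ^-monoˡ-< : ∀ n → 0# ≤ x → x < y → x ^ suc n < y ^ suc n
  ^-monoˡ-< {x} {y} n 0≤x x<y = ≤-<-trans
    (*-monoˡ-≤ 0≤x (^-monoˡ-≤ n 0≤x (<⇒≤ x<y)))
    (*-monoʳ-< (^-positive n (≤-<-trans 0≤x x<y)) x<y)

  ^-cancel-≤ : ∀ n → 0# ≤ y → x ^ suc n ≤ y ^ suc n → x ≤ y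
  ^-cancel-≤ n 0≤y x^n≤y^n = ≮⇒≥ λ y<x → <⇒≱ (^-monoˡ-< n 0≤y y<x) x^n≤y^n

  ∣x∣<y : - y < x → x < y → ∣ x ∣ < y
  ∣x∣<y {y} {x} -y<x x<y with ⊔-sel x (- x)
  ... | inj₁ ∣x∣≈x  = <-respˡ-≈ (sym ∣x∣≈x) x<y
  ... | inj₂ ∣x∣≈-x = <-respˡ-≈ (sym ∣x∣≈-x)
    (linear< -y<x (solve 2 (λ x y → :- y :+ y := x :+ :- x) refl x y))

-- Integer parts and the distance to the nearest integer.

module IntegerPart (ℝ : CompleteOrderedField) where

  open RealAnalysis ℝ
  open OrderedField ℝ

  private variable
    c t x y z ε : Carrier

  0<2 : 0# < fromℕ 2
  0<2 = fromℕ-positive {2} (s≤s z≤n)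

  ½ : Carrier
  ½ = 1# / fromℕ 2

  ½+½≈1 : ½ + ½ ≈ 1#
  ½+½≈1 = trans (solve 1 (λ h → h :+ h := h :* con (+ 2)) refl ½) (/-*-cancel 0<2)

  0<½ : 0# < ½
  0<½ = /-positive 0<1 0<2

  natural-floor : 0# ≤ x → ∃[ n ] (fromℕ n ≤ x × x < fromℕ (suc n))
  natural-floor {x} 0≤x with archimedean x
  ... | M , x≤M = search M (≤-<-trans x≤M (fromℕ-mono-< {M} ℕ.≤-refl))
    where
    search : ∀ m → x < fromℕ (suc m) → ∃[ n ] (fromℕ n ≤ x × x < fromℕ (suc n))
    search zero    x<1 = zero , 0≤x , x<1
    search (suc m) x<2+m with fromℕ (suc m) ≤? x
    ... | yes 1+m≤x = suc m , 1+m≤x , x<2+m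
    ... | no  1+m≰x = search m (≰⇒> 1+m≰x)

  -- Abstract because with-abstractions over an application of integer-floor
  -- would otherwise normalise the solver-generated proofs in it.
  abstract
    integer-floor : ∀ x → ∃[ k ] (fromℤ k ≤ x × x < fromℤ k + 1#)
    integer-floor x = shift (natural-floor
        (linear≤ -x≤M (solve 2 (λ x m → :- x :+ (x :+ m) := m :+ con (+ 0)) refl x (fromℕ M))))
      where
      M : ℕ
      M = proj₁ (archimedean (- x))
      -x≤M : - x ≤ fromℕ M
      -x≤M = proj₂ (archimedean (- x))
      shift : ∃[ n ] (fromℕ n ≤ x + fromℕ M × x + fromℕ M < fromℕ (suc n)) →
              ∃[ k ] (fromℤ k ≤ x × x < fromℤ k + 1#)
      shift (n , n≤x+M , x+M<1+n) = n ℤ.⊖ M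
        , ≤-respˡ-≈ (sym (fromℤ-⊖ n M))
            (linear≤ n≤x+M (solve 3 (λ n m x → n :+ x := x :+ m :+ (n :- m))
                refl (fromℕ n) (fromℕ M) x))
        , <-respʳ-≈ (+-congʳ (sym (fromℤ-⊖ n M)))
            (linear< x+M<1+n (solve 4 (λ n m x o → x :+ m :+ (n :- m :+ o) := o :+ n :+ x)
                refl (fromℕ n) (fromℕ M) x 1#))

  fromℤ-<⇒≤ : ∀ i j → fromℤ i < fromℤ j + 1# → fromℤ i ≤ fromℤ j
  fromℤ-<⇒≤ i j i<j+1 = linear≤ (nonPositive (i ℤ.- j) (<-respˡ-≈ (sym i-j)
      (linear< i<j+1 (solve 3 (λ i j o → i :+ o := j :+ o :+ (i :- j))
          refl (fromℤ i) (fromℤ j) 1#))))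
      (trans (+-congʳ i-j) (solve 2 (λ i j → i :- j :+ j := con (+ 0) :+ i)
          refl (fromℤ i) (fromℤ j)))
    where
    i-j : fromℤ (i ℤ.- j) ≈ fromℤ i - fromℤ j
    i-j = trans (fromℤ-+ i (ℤ.- j)) (+-congˡ (fromℤ-neg j))
    nonPositive : ∀ d → fromℤ d < 1# → fromℤ d ≤ 0#
    nonPositive (+ zero)  _   = ≤-refl
    nonPositive (+ suc n) d<1 = contradiction (1≤fromℕ {suc n} (s≤s z≤n)) (<⇒≱ d<1)
    nonPositive -[1+ n ]  _   = linear≤ (fromℕ-nonNegative (suc n))
      (solve 1 (λ n → con (+ 0) :+ con (+ 0) := n :+ :- n) refl (fromℕ (suc n)))

  fromℤ-<⇒+1≤ : ∀ i j → fromℤ i < fromℤ j → fromℤ i + 1# ≤ fromℤ j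
  fromℤ-<⇒+1≤ i j i<j = ≮⇒≥ λ j<i+1 → <⇒≱ i<j (fromℤ-<⇒≤ j i j<i+1)

  -- The set whose supremum defines the floor has y as its greatest element. Keeping y apart from
  -- `fromℤ k` allows floors to be given in forms such as `⌊ z ⌋ + 1#`.
  ⌊⌋-unique : ∀ k → y ≈ fromℤ k → y ≤ x → x < y + 1# → ⌊ x ⌋ ≈ y
  ⌊⌋-unique {y} {x} k y≈k y≤x x<y+1 = ≤-antisym (proj₂ isLub k-upper) (proj₁ isLub
      (k , y≈k , ≤-respˡ-≈ y≈k y≤x))
    where
    k-upper : UpperBound _ y
    k-upper {z} (i , z≈i , i≤x) = ≤-respˡ-≈ (sym z≈i) (≤-respʳ-≈ (sym y≈k)
      (fromℤ-<⇒≤ i k (≤-<-trans i≤x (<-respʳ-≈ (+-congʳ y≈k) x<y+1))))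
    isLub = sup-isLub (λ y → ∃[ i ] (y ≈ fromℤ i × fromℤ i ≤ x))
      (y , k , y≈k , ≤-respˡ-≈ y≈k y≤x) (y , k-upper)

  ⌊⌋-fromℤ : ∀ x → ∃[ k ] (⌊ x ⌋ ≈ fromℤ k)
  ⌊⌋-fromℤ x with integer-floor x
  ... | k , k≤x , x<k+1 = k , ⌊⌋-unique k refl k≤x x<k+1

  ⌊x⌋≤x : ∀ x → ⌊ x ⌋ ≤ x
  ⌊x⌋≤x x with integer-floor x
  ... | k , k≤x , x<k+1 = ≤-respˡ-≈ (sym (⌊⌋-unique k refl k≤x x<k+1)) k≤x

  x<⌊x⌋+1 : ∀ x → x < ⌊ x ⌋ + 1#
  x<⌊x⌋+1 x with integer-floor x
  ... | k , k≤x , x<k+1 = <-respʳ-≈ (+-congʳ (sym (⌊⌋-unique k refl k≤x x<k+1))) x<k+1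

  ⌊⌋-cong : x ≈ y → ⌊ x ⌋ ≈ ⌊ y ⌋
  ⌊⌋-cong {x} {y} x≈y with ⌊⌋-fromℤ y
  ... | k , ⌊y⌋≈k = ⌊⌋-unique k ⌊y⌋≈k (≤-respʳ-≈ (sym x≈y) (⌊x⌋≤x y)) (<-respˡ-≈ (sym x≈y)
      (x<⌊x⌋+1 y))

  -- Both sides are 2⌊z⌋ if the fractional part of z is below ½, and 2⌊z⌋ + 1 otherwise.
  ⌊⌋-double : ∀ z → ⌊ z ⌋ + ⌊ z + ½ ⌋ ≈ ⌊ z + z ⌋
  ⌊⌋-double z with ⌊⌋-fromℤ z | (⌊ z ⌋ + ½) ≤? z
  ... | k , ⌊z⌋≈k | no ⌊z⌋+½≰z = begin-equality
      ⌊ z ⌋ + ⌊ z + ½ ⌋   ≈⟨ +-congˡ (⌊⌋-unique k ⌊z⌋≈k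
                              (linear≤ (⌊x⌋≤x z ⊕ <⇒≤ 0<½)
                                  (solve 3 (λ f z h → f :+ con (+ 0) :+ (z :+ h)
                                  := z :+ h :+ f) refl ⌊ z ⌋ z ½))
                              (linear< (z<⌊z⌋+½ <⊕ ≤-reflexive ½+½≈1)
                                  (solve 4 (λ f z h o → z :+ (h :+ h) :+ (f :+ o)
                                  := f :+ h :+ o :+ (z :+ h)) refl ⌊ z ⌋ z ½ 1#))) ⟩
      ⌊ z ⌋ + ⌊ z ⌋       ≈⟨ ⌊⌋-unique (k ℤ.+ k) (trans (+-cong ⌊z⌋≈k ⌊z⌋≈k) (sym (fromℤ-+ k k)))
                              (⌊x⌋≤x z ⊕ ⌊x⌋≤x z)
                              (linear< (z<⌊z⌋+½ <⊕ <⇒≤ z<⌊z⌋+½ ⊕ ≤-reflexive ½+½≈1)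
                                (solve 4 (λ f z h o → z :+ (z :+ (h :+ h)) :+ (f :+ f :+ o)
                                    := f :+ h :+ (f :+ h :+ o) :+ (z :+ z)) refl ⌊ z ⌋ z ½ 1#)) ⟨
      ⌊ z + z ⌋           ∎
    where
    open ≤-Reasoning
    z<⌊z⌋+½ = ≰⇒> ⌊z⌋+½≰z
  ... | k , ⌊z⌋≈k | yes ⌊z⌋+½≤z = begin-equality
      ⌊ z ⌋ + ⌊ z + ½ ⌋
          ≈⟨ +-congˡ (⌊⌋-unique (k ℤ.+ + 1) (trans (+-cong ⌊z⌋≈k 1≈fromℤ1) (sym (fromℤ-+ k (+ 1))))
                              (linear≤ (⌊z⌋+½≤z ⊕ ≤-reflexive (sym ½+½≈1))
                                  (solve 4 (λ f z h o → f :+ h :+ o :+ (z :+ h)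
                                  := z :+ (h :+ h) :+ (f :+ o)) refl ⌊ z ⌋ z ½ 1#))
                              (linear< (x<⌊x⌋+1 z <⊕ <⇒≤ 0<½ ⊕ ≤-reflexive ½+½≈1)
                                  (solve 4 (λ f z h o → z :+ (con (+ 0) :+ (h :+ h)) :+
                                  (f :+ o :+ o) := f :+ o :+ (h :+ o) :+ (z :+ h))
                                  refl ⌊ z ⌋ z ½ 1#))) ⟩
      ⌊ z ⌋ + (⌊ z ⌋ + 1#)
          ≈⟨ ⌊⌋-unique (k ℤ.+ (k ℤ.+ + 1)) (trans (+-cong ⌊z⌋≈k (+-cong ⌊z⌋≈k 1≈fromℤ1)) (trans
          (+-congˡ (sym (fromℤ-+ k (+ 1)))) (sym (fromℤ-+ k _))))
                              (linear≤ (⌊z⌋+½≤z ⊕ ⌊z⌋+½≤z ⊕ ≤-reflexive (sym ½+½≈1))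
                                 (solve 4 (λ f z h o → f :+ h :+ (f :+ h :+ o) :+ (z :+ z)
                                     := z :+ (z :+ (h :+ h)) :+ (f :+ (f :+ o))) refl ⌊ z ⌋ z ½ 1#))
                              (linear< (x<⌊x⌋+1 z <⊕ <⇒≤ (x<⌊x⌋+1 z))
                                 (solve 3 (λ f z o → z :+ z :+ (f :+ (f :+ o) :+ o)
                                     := f :+ o :+ (f :+ o) :+ (z :+ z)) refl ⌊ z ⌋ z 1#)) ⟨
      ⌊ z + z ⌋             ∎
    where
    open ≤-Reasoning
    1≈fromℤ1 : 1# ≈ fromℤ (+ 1)
    1≈fromℤ1 = sym (+-identityʳ 1#)

  0≤∣x∣ : ∀ x → 0# ≤ ∣ x ∣
  0≤∣x∣ x with ≤-total 0# x
  ... | inj₁ 0≤x = ≤-trans 0≤x (x≤x⊔y x (- x))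
  ... | inj₂ x≤0 = ≤-trans (linear≤ x≤0 (solve 1 (λ x → x :+ :- x := con (+ 0) :+ con (+ 0))
      refl x)) (x≤y⊔x x (- x))

  -- An infimum is by definition a negated supremum, so the set in question is that of the negated
  -- distances, which 0 bounds from above.
  ‖‖-isLub : ∀ t → IsLub (λ y → ∃[ k ] - y ≈ ∣ t - fromℤ k ∣) (sup (λ y →
      ∃[ k ] - y ≈ ∣ t - fromℤ k ∣))
  ‖‖-isLub t = sup-isLub _ (- ∣ t - fromℤ (+ 0) ∣ , + 0 , -‿involutive _) (0# , λ { {y} (k , -y≈) →
    linear≤ (≤-respʳ-≈ (sym -y≈) (0≤∣x∣ (t - fromℤ k)))
      (solve 1 (λ y → con (+ 0) :+ con (+ 0) := :- y :+ y) refl y) })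

  ‖t‖≤∣t-k∣ : ∀ t k → ‖ t ‖ ≤ ∣ t - fromℤ k ∣
  ‖t‖≤∣t-k∣ t k = linear≤ (proj₁ (‖‖-isLub t) (k , -‿involutive _))
    (solve 2 (λ a s → :- a :+ a := s :+ :- s) refl ∣ t - fromℤ k ∣ _)

  ≤‖t‖ : (∀ k → c ≤ ∣ t - fromℤ k ∣) → c ≤ ‖ t ‖
  ≤‖t‖ {c} {t} c≤ = linear≤ (proj₂ (‖‖-isLub t) {v = - c} λ { {y} (k , -y≈) →
      linear≤ (≤-respʳ-≈ (sym -y≈) (c≤ k)) (solve 2 (λ c y → c :+ :- c := :- y :+ y) refl c y) })
    (solve 2 (λ c s → s :+ :- s := :- c :+ c) refl c _)

  -- Every integer is at most k or at least k + 1, and t keeps the distance c from both.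
  between⇒≤‖t‖ : ∀ k → fromℤ k + c ≤ t → t + c ≤ fromℤ k + 1# → c ≤ ‖ t ‖
  between⇒≤‖t‖ {c} {t} k k+c≤t t+c≤k+1 = ≤‖t‖ bound
    where
    bound : ∀ j → c ≤ ∣ t - fromℤ j ∣
    bound j with fromℤ j ≤? fromℤ k
    ... | yes j≤k = ≤-trans (linear≤ (k+c≤t ⊕ j≤k)
      (solve 4 (λ k c t j → k :+ c :+ j :+ (t :- j) := t :+ k :+ c)
          refl (fromℤ k) c t (fromℤ j))) (x≤x⊔y _ _)
    ... | no  j≰k = ≤-trans (linear≤ (t+c≤k+1 ⊕ fromℤ-<⇒+1≤ k j (≰⇒> j≰k))
      (solve 5 (λ k c t j o → t :+ c :+ (k :+ o) :+ (:- (t :- j)) := k :+ o :+ j :+ c)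
          refl (fromℤ k) c t (fromℤ j) 1#)) (x≤y⊔x _ _)

  -- The number of integers in [t - ε, t + ε] is ⌊t + ε⌋ - ⌈t - ε⌉ + 1; the last two terms combine
  -- into the second floor.
  hit : Carrier → Carrier → Carrier
  hit ε t = ⌊ ε + t ⌋ + ⌊ ε + (1# - t) ⌋

  hit-cong : ∀ ε → x ≈ y → hit ε x ≈ hit ε y
  hit-cong ε x≈y = +-cong (⌊⌋-cong (+-congˡ x≈y)) (⌊⌋-cong (+-congˡ (+-congˡ (-‿cong x≈y))))

  -- The largest integer k ≤ t + ε lies in the window [t - ε, t + ε] exactly if t ≤ k + ε, and 2ε <
  -- 1 excludes a second one.
  hit-indicator : ∀ t → 0# ≤ ε → ε + ε < 1# →
    (‖ t ‖ ≤ ε × hit ε t ≈ 1#) ⊎ (ε < ‖ t ‖ × hit ε t ≈ 0#)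
  hit-indicator {ε} t 0≤ε 2ε<1 with ⌊⌋-fromℤ (ε + t)
  ... | k , f≈k with t ≤? fromℤ k + ε
  ...   | yes t≤k+ε = inj₁
    ( ≤-trans (‖t‖≤∣t-k∣ t k) (⊔-lub
        (linear≤ t≤k+ε (solve 3 (λ t k ε → t :+ ε := k :+ ε :+ (t :- k)) refl t (fromℤ k) ε))
        (linear≤ (≤-respˡ-≈ f≈k (⌊x⌋≤x (ε + t))) (solve 3 (λ t k ε → k :+ ε
            := ε :+ t :+ (:- (t :- k))) refl t (fromℤ k) ε)))
    , trans (+-cong f≈k (⌊⌋-unique (+ 1 ℤ.- k) (trans (+-cong (sym (+-identityʳ 1#)) (sym
        (fromℤ-neg k))) (sym (fromℤ-+ (+ 1) (ℤ.- k))))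
        (linear≤ t≤k+ε (solve 4 (λ t k ε o → t :+ (ε :+ (o :- t)) := k :+ ε :+ (o :- k))
            refl t (fromℤ k) ε 1#))
        (linear< (2ε<1 <⊕ ≤-respˡ-≈ f≈k (⌊x⌋≤x (ε + t)))
          (solve 4 (λ t k ε o → ε :+ ε :+ k :+ (o :- k :+ o)
              := o :+ (ε :+ t) :+ (ε :+ (o :- t))) refl t (fromℤ k) ε 1#))))
      (solve 2 (λ k o → k :+ (o :- k) := o) refl (fromℤ k) 1#))
  ...   | no  t≰k+ε = inj₂
    ( distance
    , trans (+-cong f≈k (⌊⌋-unique (ℤ.- k) (sym (fromℤ-neg k))
        (linear≤ (<⇒≤ ε+t<k+1 ⊕ 0≤ε ⊕ 0≤ε)
            (solve 4 (λ t k ε o → ε :+ t :+ (con (+ 0) :+ con (+ 0)) :+ (ε :+ (o :- t))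
            := k :+ o :+ (ε :+ ε) :+ (:- k)) refl t (fromℤ k) ε 1#))
        (linear< k+ε<t (solve 4 (λ t k ε o → k :+ ε :+ (:- k :+ o) := t :+ (ε :+ (o :- t)))
            refl t (fromℤ k) ε 1#))))
      (-‿inverseʳ _))
    where
    k+ε<t = ≰⇒> t≰k+ε
    ε+t<k+1 : ε + t < fromℤ k + 1#
    ε+t<k+1 = <-respʳ-≈ (+-congʳ f≈k) (x<⌊x⌋+1 (ε + t))
    distance : ε < ‖ t ‖
    -- Both gaps, to k and to k + 1, exceed ε; the smaller one is a lower bound for ‖t‖.
    distance with ≤-total (t - fromℤ k) (fromℤ k + 1# - t)
    ... | inj₁ l≤r = <-≤-trans
      (linear< k+ε<t (solve 3 (λ t k ε → k :+ ε :+ (t :- k) := t :+ ε) refl t (fromℤ k) ε))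
      (between⇒≤‖t‖ k (≤-reflexive (solve 2 (λ t k → k :+ (t :- k) := t) refl t (fromℤ k)))
        (linear≤ l≤r (solve 3 (λ t k o → t :- k :+ (k :+ o) := k :+ o :- t :+ (t :+ (t :- k)))
            refl t (fromℤ k) 1#)))
    ... | inj₂ r≤l = <-≤-trans
      (linear< ε+t<k+1 (solve 4 (λ t k ε o → ε :+ t :+ (k :+ o :- t) := k :+ o :+ ε)
          refl t (fromℤ k) ε 1#))
      (between⇒≤‖t‖ k
        (linear≤ r≤l (solve 3 (λ t k o → k :+ o :- t :+ t := t :- k :+ (k :+ (k :+ o :- t)))
            refl t (fromℤ k) 1#))
        (≤-reflexive (solve 3 (λ t k o → t :+ (k :+ o :- t) := k :+ o) refl t (fromℤ k) 1#)))

-- Real powers defined by suprema.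

module RealPower (ℝ : CompleteOrderedField) where

  open RealAnalysis ℝ
  open OrderedField ℝ
  open IntegerPart ℝ using (natural-floor)

  private variable
    b e e′ v x y z : Carrier

  BelowPower : Carrier → Carrier → Pred Carrier 0ℓ
  BelowPower b e y = 0# ≤ y ×
    (∃[ p ] ∃[ r ] (fromℕ p / fromℕ (suc r) ≤ e × y ^ suc r ≤ b ^ p))

  fromℕ-suc-positive : ∀ r → 0# < fromℕ (suc r)
  fromℕ-suc-positive r = fromℕ-positive {suc r} (s≤s z≤n)

  p/q≤e⇒p≤eq : ∀ p r → fromℕ p / fromℕ (suc r) ≤ e → fromℕ p ≤ e * fromℕ (suc r)
  p/q≤e⇒p≤eq p r = x/z≤y⇒x≤yz (fromℕ-suc-positive r)

  1∈BelowPower : 0# ≤ e → 1# ∈ BelowPower b e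
  1∈BelowPower 0≤e = 0≤1 , 0 , 0 , x/z≤y (fromℕ-suc-positive 0) (*-nonNegative 0≤e
      (fromℕ-nonNegative 1))
    , ≤-reflexive (1^n≈1 1)

  BelowPower-bounded : 1# ≤ b → ∀ M → e ≤ fromℕ M → UpperBound (BelowPower b e) (b ^ M)
  BelowPower-bounded {b} {e} 1≤b M e≤M {y} (0≤y , p , r , p/q≤e , y^q≤b^p) =
    ^-cancel-≤ r (^-nonNegative M (≤-trans 0≤1 1≤b)) (begin
      y ^ suc r             ≤⟨ y^q≤b^p ⟩
      b ^ p                 ≤⟨ ^-monoʳ-≤ 1≤b p≤Mq ⟩
      b ^ (M ℕ.* suc r)     ≈⟨ ^-assocʳ b M (suc r) ⟨
      (b ^ M) ^ suc r       ∎)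
    where
    open ≤-Reasoning
    p≤Mq : p ℕ.≤ M ℕ.* suc r
    p≤Mq = fromℕ-cancel-≤ (begin
      fromℕ p                  ≤⟨ p/q≤e⇒p≤eq p r p/q≤e ⟩
      e * fromℕ (suc r)        ≤⟨ *-monoʳ-≤ (fromℕ-nonNegative (suc r)) e≤M ⟩
      fromℕ M * fromℕ (suc r)  ≈⟨ fromℕ-* M (suc r) ⟨
      fromℕ (M ℕ.* suc r)      ∎)

  ^ʳ-isLub : 1# ≤ b → 0# ≤ e → IsLub (BelowPower b e) (b ^ʳ e)
  ^ʳ-isLub {b} {e} 1≤b 0≤e = sup-isLub (BelowPower b e) (1# , 1∈BelowPower 0≤e)
    (b ^ proj₁ (archimedean e) , BelowPower-bounded 1≤b (proj₁ (archimedean e)) (proj₂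
        (archimedean e)))

  1≤^ʳ : 1# ≤ b → 0# ≤ e → 1# ≤ b ^ʳ e
  1≤^ʳ 1≤b 0≤e = proj₁ (^ʳ-isLub 1≤b 0≤e) (1∈BelowPower 0≤e)

  ^ʳ-positive : 1# ≤ b → 0# ≤ e → 0# < b ^ʳ e
  ^ʳ-positive 1≤b 0≤e = <-≤-trans 0<1 (1≤^ʳ 1≤b 0≤e)

  -- The constant does not depend on h: in the induction h ≤ 1 bounds the quadratic term by a linear
  -- one. The lemma serves to enlarge a number slightly while keeping its power under a bound.
  ^-lipschitz : 0# ≤ x → ∀ n → ∃[ C ] (0# ≤ C × (∀ {h} → 0# ≤ h → h ≤ 1# →
      (x + h) ^ n ≤ x ^ n + h * C))
  ^-lipschitz {x} 0≤x zero = 0# , ≤-refl , λ {h} _ _ → ≤-reflexive (solve 2 (λ h o → o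
      := o :+ h :* con (+ 0)) refl h 1#)
  ^-lipschitz {x} 0≤x (suc n) with ^-lipschitz 0≤x n
  ... | C , 0≤C , bound = x ^ n + x * C + C
      , +-nonNegative (+-nonNegative (^-nonNegative n 0≤x) (*-nonNegative 0≤x 0≤C)) 0≤C
      , λ {h} 0≤h h≤1 → begin
        (x + h) * (x + h) ^ n
            ≤⟨ *-monoˡ-≤ (+-nonNegative 0≤x 0≤h) (bound 0≤h h≤1) ⟩
        (x + h) * (x ^ n + h * C)
            ≈⟨ solve 4 (λ x h C X → (x :+ h) :* (X :+ h :* C)
            := x :* X :+ h :* (X :+ x :* C) :+ h :* (h :* C)) refl x h C (x ^ n) ⟩
        x * x ^ n + h * (x ^ n + x * C) + h * (h * C)
            ≤⟨ ≤-refl ⊕ *-monoˡ-≤ 0≤h (≤-respʳ-≈ (*-identityˡ C) (*-monoʳ-≤ 0≤C h≤1)) ⟩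
        x * x ^ n + h * (x ^ n + x * C) + h * C
            ≈⟨ solve 4 (λ x h C X → x :* X :+ h :* (X :+ x :* C) :+ h :* C
            := x :* X :+ h :* (X :+ x :* C :+ C)) refl x h C (x ^ n) ⟩
        x * x ^ n + h * (x ^ n + x * C + C)    ∎
    where
    open ≤-Reasoning
    +-nonNegative : 0# ≤ y → 0# ≤ z → 0# ≤ y + z
    +-nonNegative 0≤y 0≤z = ≤-respˡ-≈ (+-identityˡ 0#) (0≤y ⊕ 0≤z)

  -- As in the construction of roots: if u^q were below b^p, some u + h with h > 0 would still
  -- belong to the set whose supremum is u.
  b^p≤[b^ʳe]^q : 1# ≤ b → ∀ p r → fromℕ p / fromℕ (suc r) ≤ e → b ^ p ≤ (b ^ʳ e) ^ suc r
  b^p≤[b^ʳe]^q {b} {e} 1≤b p r p/q≤e = ≮⇒≥ λ u^q<b^p → increase u^q<b^p (^-lipschitz 0≤u (suc r))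
    where
    open ≤-Reasoning
    0≤e : 0# ≤ e
    0≤e = ≤-trans (x≤y/z (fromℕ-suc-positive r) (≤-respˡ-≈ (sym (zeroˡ _))
        (fromℕ-nonNegative p))) p/q≤e
    u = b ^ʳ e
    0≤u = ≤-trans 0≤1 (1≤^ʳ 1≤b 0≤e)
    increase : u ^ suc r < b ^ p →
      ¬ (∃[ C ] (0# ≤ C × (∀ {h} → 0# ≤ h → h ≤ 1# → (u + h) ^ suc r ≤ u ^ suc r + h * C)))
    increase u^q<b^p (C , 0≤C , bound) = <⇒≱ u<u+h (proj₁ (^ʳ-isLub 1≤b 0≤e)
        (≤-trans 0≤u (<⇒≤ u<u+h) , p , r , p/q≤e , (begin
          (u + h) ^ suc r       ≤⟨ bound (<⇒≤ 0<h) h≤1 ⟩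
          u ^ suc r + h * C     ≤⟨ ≤-refl ⊕ hC≤d ⟩
          u ^ suc r + d         ≈⟨ solve 2 (λ u b → u :+ (b :- u) := b) refl (u ^ suc r) (b ^ p) ⟩
          b ^ p                 ∎)))
      where
      d = b ^ p - u ^ suc r
      0<d : 0# < d
      0<d = linear< u^q<b^p (solve 2 (λ u b → u :+ (b :- u) := b :+ con (+ 0))
          refl (u ^ suc r) (b ^ p))
      C+d≥d : d ≤ C + d
      C+d≥d = ≤-respˡ-≈ (+-identityˡ d) (0≤C ⊕ ≤-refl)
      0<C+d : 0# < C + d
      0<C+d = <-≤-trans 0<d C+d≥d
      -- The denominator gives h ≤ 1 and h * C ≤ d at once, and is positive even for C = 0.
      h = d / (C + d)
      0<h : 0# < h
      0<h = /-positive 0<d 0<C+d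
      h≤1 : h ≤ 1#
      h≤1 = x/z≤y 0<C+d (≤-respʳ-≈ (sym (*-identityˡ _)) C+d≥d)
      hC≤d : h * C ≤ d
      hC≤d = begin
        h * C        ≤⟨ *-monoˡ-≤ (<⇒≤ 0<h) (≤-respˡ-≈ (+-identityʳ C) (≤-refl ⊕ <⇒≤ 0<d)) ⟩
        h * (C + d)  ≈⟨ /-*-cancel 0<C+d ⟩
        d            ∎
      u<u+h : u < u + h
      u<u+h = linear< 0<h (solve 2 (λ u h → con (+ 0) :+ (u :+ h) := h :+ u) refl u h)

  -- The exponents p/q and p′/q′ are brought to the common denominator qq′, and the comparison is
  -- made between powers with exponent qq′.
  BelowPower-* : 1# ≤ b → ∀ k → e + e′ ≤ fromℕ k → y ∈ BelowPower b e → z ∈ BelowPower b e′ →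
      y * z ≤ b ^ k
  BelowPower-* {b} {e} {e′} {y} {z} 1≤b k e+e′≤k (0≤y , p , r , p/q≤e , y^q≤b^p)
      (0≤z , p′ , r′ , p′/q′≤e′ , z^q′≤b^p′) =
    ^-cancel-≤ (r′ ℕ.+ r ℕ.* suc r′) (^-nonNegative k (≤-trans 0≤1 1≤b)) (begin
      (y * z) ^ (q ℕ.* q′)                    ≈⟨ ^-distrib-* y z (q ℕ.* q′) ⟩
      y ^ (q ℕ.* q′) * z ^ (q ℕ.* q′)
          ≈⟨ *-cong (^-assocʳ y q q′) (trans (^-assocʳ z q′ q) (^-congʳ z (ℕ.*-comm q′ q))) ⟨
      (y ^ q) ^ q′ * (z ^ q′) ^ q
          ≤⟨ *-mono-≤ (^-nonNegative q′ (^-nonNegative q 0≤y)) (^-monoˡ-≤ q′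
          (^-nonNegative q 0≤y) y^q≤b^p)
                                                   (^-nonNegative q (^-nonNegative q′ 0≤z))
                                                       (^-monoˡ-≤ q (^-nonNegative q′ 0≤z) z^q′≤b^p′) ⟩
      (b ^ p) ^ q′ * (b ^ p′) ^ q             ≈⟨ *-cong (^-assocʳ b p q′) (^-assocʳ b p′ q) ⟩
      b ^ (p ℕ.* q′) * b ^ (p′ ℕ.* q)         ≈⟨ ^-homo-* b (p ℕ.* q′) (p′ ℕ.* q) ⟨
      b ^ (p ℕ.* q′ ℕ.+ p′ ℕ.* q)             ≤⟨ ^-monoʳ-≤ 1≤b exponents ⟩
      b ^ (k ℕ.* (q ℕ.* q′))                  ≈⟨ ^-assocʳ b k (q ℕ.* q′) ⟨
      (b ^ k) ^ (q ℕ.* q′)                    ∎)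
    where
    open ≤-Reasoning
    q = suc r
    q′ = suc r′
    exponents : p ℕ.* q′ ℕ.+ p′ ℕ.* q ℕ.≤ k ℕ.* (q ℕ.* q′)
    exponents = fromℕ-cancel-≤ (begin
      fromℕ (p ℕ.* q′ ℕ.+ p′ ℕ.* q)               ≈⟨ fromℕ-+ (p ℕ.* q′) (p′ ℕ.* q) ⟩
      fromℕ (p ℕ.* q′) + fromℕ (p′ ℕ.* q)         ≈⟨ +-cong (fromℕ-* p q′) (fromℕ-* p′ q) ⟩
      fromℕ p * fromℕ q′ + fromℕ p′ * fromℕ q
          ≤⟨ *-monoʳ-≤ (fromℕ-nonNegative q′) (p/q≤e⇒p≤eq p r p/q≤e)
                                                       ⊕ *-monoʳ-≤ (fromℕ-nonNegative q)
                                                           (p/q≤e⇒p≤eq p′ r′ p′/q′≤e′) ⟩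
      e * fromℕ q * fromℕ q′ + e′ * fromℕ q′ * fromℕ q
        ≈⟨ solve 4 (λ e e′ q q′ → e :* q :* q′ :+ e′ :* q′ :* q := (e :+ e′) :* (q :* q′))
            refl e e′ (fromℕ q) (fromℕ q′) ⟩
      (e + e′) * (fromℕ q * fromℕ q′)
          ≤⟨ *-monoʳ-≤ (*-nonNegative (fromℕ-nonNegative q) (fromℕ-nonNegative q′)) e+e′≤k ⟩
      fromℕ k * (fromℕ q * fromℕ q′)              ≈⟨ *-congˡ (fromℕ-* q q′) ⟨
      fromℕ k * fromℕ (q ℕ.* q′)                  ≈⟨ fromℕ-* k (q ℕ.* q′) ⟨
      fromℕ (k ℕ.* (q ℕ.* q′))                    ∎)

  -- The suprema are removed one at a time, by dividing the bound by the other factor; y = 0, where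
  -- this is impossible, is treated apart.
  ^ʳ-*-≤ : 1# ≤ b → 0# ≤ e → 0# ≤ e′ → ∀ k → e + e′ ≤ fromℕ k → b ^ʳ e * b ^ʳ e′ ≤ b ^ k
  ^ʳ-*-≤ {b} {e} {e′} 1≤b 0≤e 0≤e′ k e+e′≤k = x/z≤y⇒x≤yz′ (proj₂ (^ʳ-isLub 1≤b 0≤e) (λ y∈ →
      x≤y/z 0<w (below y∈)))
    where
    w = b ^ʳ e′
    0<w : 0# < w
    0<w = ^ʳ-positive 1≤b 0≤e′
    x/z≤y⇒x≤yz′ : x ≤ z / w → x * w ≤ z
    x/z≤y⇒x≤yz′ x≤z/w = ≤-respʳ-≈ (/-*-cancel 0<w) (*-monoʳ-≤ (<⇒≤ 0<w) x≤z/w)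
    below : y ∈ BelowPower b e → y * w ≤ b ^ k
    below {y} y∈@(0≤y , _) with y ≤? 0#
    ... | yes y≤0 = ≤-respˡ-≈ (sym (trans (*-congʳ (≤-antisym y≤0 0≤y)) (zeroˡ w)))
        (^-nonNegative k (≤-trans 0≤1 1≤b))
    ... | no  y≰0 = ≤-respˡ-≈ (*-comm w y) (≤-respʳ-≈ (/-*-cancel 0<y) (*-monoʳ-≤ 0≤y (proj₂
        (^ʳ-isLub 1≤b 0≤e′)
        λ z∈ → x≤y/z 0<y (≤-respˡ-≈ (*-comm _ _) (BelowPower-* 1≤b k e+e′≤k y∈ z∈)))))
      where 0<y = ≰⇒> y≰0

  bernoulli : 0# ≤ x → ∀ n → 1# + fromℕ n * x ≤ (1# + x) ^ n
  bernoulli {x} 0≤x zero    = ≤-reflexive (trans (+-congˡ (zeroˡ x)) (+-identityʳ 1#))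
  bernoulli {x} 0≤x (suc n) = begin
    1# + (1# + fromℕ n) * x
        ≤⟨ linear≤ (*-nonNegative (fromℕ-nonNegative n) (*-nonNegative 0≤x 0≤x))
      (solve 3 (λ o n x → con (+ 0) :+ (o :+ (o :+ n) :* x :+ n :* (x :* x))
          := n :* (x :* x) :+ (o :+ (o :+ n) :* x)) refl 1# (fromℕ n) x) ⟩
    1# + (1# + fromℕ n) * x + fromℕ n * (x * x)
        ≈⟨ +-congʳ (+-congˡ (distribʳ x 1# (fromℕ n))) ⟩
    1# + (1# * x + fromℕ n * x) + fromℕ n * (x * x)    ≈⟨ +-congʳ (+-assoc _ _ _) ⟨
    1# + 1# * x + fromℕ n * x + fromℕ n * (x * x)
        ≈⟨ +-congʳ (+-cong (+-congˡ (*-identityˡ x)) (sym (*-identityˡ (fromℕ n * x)))) ⟩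
    1# + x + 1# * (fromℕ n * x) + fromℕ n * (x * x)
        ≈⟨ +-congʳ (+-congʳ (trans (+-congˡ (sym (*-identityʳ x))) (+-congʳ (sym
        (*-identityʳ 1#))))) ⟩
    1# * 1# + x * 1# + 1# * (fromℕ n * x) + fromℕ n * (x * x)
        ≈⟨ solve 3 (λ o n x → o :* o :+ x :* o :+ o :* (n :* x) :+ n :* (x :* x)
        := (o :+ x) :* (o :+ n :* x)) refl 1# (fromℕ n) x ⟩
    (1# + x) * (1# + fromℕ n * x)
        ≤⟨ *-monoˡ-≤ (≤-respˡ-≈ (+-identityˡ 0#) (0≤1 ⊕ 0≤x)) (bernoulli 0≤x n) ⟩
    (1# + x) * (1# + x) ^ n                            ∎
    where open ≤-Reasoning

  -- A constant factor disappears under roots of growing order: y = (1 + h)x with h > 0 would keep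
  -- all powers of 1 + h below C, against Bernoulli's inequality.
  ^-bounded⇒≤ : ∀ {C} → 0# < x → (∀ r → y ^ suc r ≤ x ^ suc r * C) → y ≤ x
  ^-bounded⇒≤ {x} {y} {C} 0<x bound = ≮⇒≥ λ x<y → contradiction′ x<y
    where
    open ≤-Reasoning
    contradiction′ : ¬ (x < y)
    contradiction′ x<y = <⇒≱ C<[1+h]^N (*-cancelʳ-≤ (^-positive N 0<x) (begin
        (1# + h) ^ N * x ^ N    ≈⟨ ^-distrib-* (1# + h) x N ⟨
        ((1# + h) * x) ^ N      ≈⟨ ^-congˡ N [1+h]x≈y ⟩
        y ^ N                   ≤⟨ bound n ⟩
        x ^ N * C               ≈⟨ *-comm _ _ ⟩
        C * x ^ N               ∎))
      where
      0<y-x : 0# < y - x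
      0<y-x = linear< x<y (solve 2 (λ x y → x :+ (y :- x) := y :+ con (+ 0)) refl x y)
      h = (y - x) / x
      0<h : 0# < h
      0<h = /-positive 0<y-x 0<x
      [1+h]x≈y : (1# + h) * x ≈ y
      [1+h]x≈y = begin-equality
        (1# + h) * x       ≈⟨ distribʳ x 1# h ⟩
        1# * x + h * x     ≈⟨ +-cong (*-identityˡ x) (/-*-cancel 0<x) ⟩
        x + (y - x)        ≈⟨ solve 2 (λ x y → x :+ (y :- x) := y) refl x y ⟩
        y                  ∎
      n = proj₁ (archimedean (C / h))
      N = suc n
      C<[1+h]^N : C < (1# + h) ^ N
      C<[1+h]^N = begin-strict
        C                    ≤⟨ x/z≤y⇒x≤yz 0<h (proj₂ (archimedean (C / h))) ⟩
        fromℕ n * h          ≤⟨ *-monoʳ-≤ (<⇒≤ 0<h) (fromℕ-mono-≤ (ℕ.n≤1+n n)) ⟩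
        fromℕ N * h
            <⟨ linear< 0<1 (solve 2 (λ o a → con (+ 0) :+ (o :+ a) := o :+ a)
            refl 1# (fromℕ N * h)) ⟩
        1# + fromℕ N * h     ≤⟨ bernoulli (<⇒≤ 0<h) N ⟩
        (1# + h) ^ N         ∎

  -- Rounding eq and e′q down to integers p and p′ loses at most one in the total exponent, since kq
  -- < p + p′ + 2. The loss is a factor b for every q, which `^-bounded⇒≤` removes.
  ^ʳ-*-≥ : 1# ≤ b → 0# ≤ e → 0# ≤ e′ → ∀ k → fromℕ k ≤ e + e′ → b ^ k ≤ b ^ʳ e * b ^ʳ e′
  ^ʳ-*-≥ {b} {e} {e′} 1≤b 0≤e 0≤e′ k k≤e+e′ =
    ^-bounded⇒≤ (*-positive (^ʳ-positive 1≤b 0≤e) (^ʳ-positive 1≤b 0≤e′)) λ r →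
      bound r (natural-floor (*-nonNegative 0≤e (fromℕ-nonNegative (suc r))))
              (natural-floor (*-nonNegative 0≤e′ (fromℕ-nonNegative (suc r))))
    where
    open ≤-Reasoning
    u = b ^ʳ e
    w = b ^ʳ e′
    0≤b = ≤-trans 0≤1 1≤b
    bound : ∀ r → ∃[ p ] (fromℕ p ≤ e * fromℕ (suc r) × e * fromℕ (suc r) < fromℕ (suc p)) →
                  ∃[ p ] (fromℕ p ≤ e′ * fromℕ (suc r) × e′ * fromℕ (suc r) < fromℕ (suc p)) →
                  (b ^ k) ^ suc r ≤ (u * w) ^ suc r * b
    bound r (p , p≤eq , eq<1+p) (p′ , p′≤e′q , e′q<1+p′) = begin
      (b ^ k) ^ q                ≈⟨ ^-assocʳ b k q ⟩
      b ^ (k ℕ.* q)              ≤⟨ ^-monoʳ-≤ 1≤b kq≤p+p′+1 ⟩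
      b ^ (p ℕ.+ p′ ℕ.+ 1)       ≈⟨ ^-homo-* b (p ℕ.+ p′) 1 ⟩
      b ^ (p ℕ.+ p′) * b ^ 1     ≈⟨ *-cong (^-homo-* b p p′) (*-identityʳ b) ⟩
      b ^ p * b ^ p′ * b
          ≤⟨ *-monoʳ-≤ 0≤b (*-mono-≤ (^-nonNegative p 0≤b) (b^p≤[b^ʳe]^q 1≤b p r (x/z≤y 0<q p≤eq))
                                                            (^-nonNegative p′ 0≤b)
                                                                (b^p≤[b^ʳe]^q 1≤b p′ r
                                                                (x/z≤y 0<q p′≤e′q))) ⟩
      u ^ q * w ^ q * b          ≈⟨ *-congʳ (^-distrib-* u w q) ⟨
      (u * w) ^ q * b            ∎
      where
      q = suc r
      0<q = fromℕ-suc-positive r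
      kq≤p+p′+1 : k ℕ.* q ℕ.≤ p ℕ.+ p′ ℕ.+ 1
      kq≤p+p′+1 = ℕ.≤-trans (ℕ.s≤s⁻¹ (fromℕ-cancel-< (begin-strict
        fromℕ (k ℕ.* q)                      ≈⟨ fromℕ-* k q ⟩
        fromℕ k * fromℕ q                    ≤⟨ *-monoʳ-≤ (fromℕ-nonNegative q) k≤e+e′ ⟩
        (e + e′) * fromℕ q                   ≈⟨ distribʳ _ _ _ ⟩
        e * fromℕ q + e′ * fromℕ q           <⟨ eq<1+p <⊕ <⇒≤ e′q<1+p′ ⟩
        fromℕ (suc p) + fromℕ (suc p′)       ≈⟨ fromℕ-+ (suc p) (suc p′) ⟨
        fromℕ (suc p ℕ.+ suc p′)             ∎)))
        (ℕ.≤-reflexive (≡.trans (ℕ.+-suc p p′) (ℕ.+-comm 1 (p ℕ.+ p′))))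

  -- Applied as N^δ * N^(2-δ) = N².
  ^ʳ-* : 1# ≤ b → 0# ≤ e → 0# ≤ e′ → ∀ k → e + e′ ≈ fromℕ k → b ^ʳ e * b ^ʳ e′ ≈ b ^ k
  ^ʳ-* 1≤b 0≤e 0≤e′ k e+e′≈k = ≤-antisym (^ʳ-*-≤ 1≤b 0≤e 0≤e′ k (≤-reflexive e+e′≈k))
                                          (^ʳ-*-≥ 1≤b 0≤e 0≤e′ k (≤-reflexive (sym e+e′≈k)))

-- Sums of integer parts along a dyadic sequence.

module Discrepancy (ℝ : CompleteOrderedField) where

  open RealAnalysis ℝ
  open OrderedField ℝ
  open IntegerPart ℝ
  open CommutativeMonoidSum +-commutativeMonoid using (sum; sum-cong-≋; ∑-distrib-+; ∑-comm)

  private variable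
    E F x y z t u : Carrier

  ∑ : ℕ → (ℕ → Carrier) → Carrier
  ∑ N f = sum {N} (f ∘ toℕ)

  ∑-cong : ∀ {f g} N → (∀ n → f n ≈ g n) → ∑ N f ≈ ∑ N g
  ∑-cong {f} {g} N f≈g = sum-cong-≋ {N} {f ∘ toℕ} {g ∘ toℕ} (f≈g ∘ toℕ)

  ∑-+ : ∀ N f g → ∑ N (λ n → f n + g n) ≈ ∑ N f + ∑ N g
  ∑-+ N f g = ∑-distrib-+ {N} (f ∘ toℕ) (g ∘ toℕ)

  ∑-swap : ∀ M N (f : ℕ → ℕ → Carrier) → ∑ M (λ m → ∑ N (f m)) ≈ ∑ N (λ n → ∑ M (λ m → f m n))
  ∑-swap M N f = ∑-comm {M} {N} (λ i j → f (toℕ i) (toℕ j))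

  ∑-last : ∀ N f → ∑ (suc N) f ≈ ∑ N f + f N
  ∑-last zero    f = +-comm _ _
  ∑-last (suc N) f = trans (+-congˡ (∑-last N (f ∘ suc))) (sym (+-assoc _ _ _))

  ∑-pairs : ∀ N f → ∑ (2 ℕ.* N) f ≈ ∑ N (λ n → f (2 ℕ.* n) + f (suc (2 ℕ.* n)))
  ∑-pairs zero    f = refl
  ∑-pairs (suc N) f = begin-equality
    ∑ (2 ℕ.* suc N) f                           ≡⟨ ≡.cong (λ K → ∑ K f) (ℕ.*-suc 2 N) ⟩
    f 0 + (f 1 + ∑ (2 ℕ.* N) (f ∘ suc ∘ suc))   ≈⟨ +-assoc _ _ _ ⟨
    f 0 + f 1 + ∑ (2 ℕ.* N) (f ∘ suc ∘ suc)     ≈⟨ +-congˡ (∑-pairs N (f ∘ suc ∘ suc)) ⟩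
    f 0 + f 1 + ∑ N (λ n → f (2 ℕ.+ 2 ℕ.* n) + f (3 ℕ.+ 2 ℕ.* n))
      ≈⟨ +-congˡ (∑-cong N λ n → reflexive (≡.cong (λ k → f k + f (suc k)) (ℕ.*-suc 2 n))) ⟨
    f 0 + f 1 + ∑ N (λ n → f (2 ℕ.* suc n) + f (suc (2 ℕ.* suc n))) ∎
    where open ≤-Reasoning

  -- Two inequalities in place of an absolute value, so that `linear≤` applies directly.
  Near : Carrier → Carrier → Carrier → Set
  Near E x y = x ≤ y + E × y ≤ x + E

  near-+ : Near E x y → Near F z t → Near (E + F) (x + z) (y + t)
  near-+ {E} {x} {y} {F} {z} {t} (x≤ , y≤) (z≤ , t≤) =
      linear≤ (x≤ ⊕ z≤) (solve 6 (λ x y z t e f → x :+ z :+ (y :+ t :+ (e :+ f))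
          := y :+ e :+ (t :+ f) :+ (x :+ z)) refl x y z t E F)
    , linear≤ (y≤ ⊕ t≤) (solve 6 (λ x y z t e f → y :+ t :+ (x :+ z :+ (e :+ f))
        := x :+ e :+ (z :+ f) :+ (y :+ t)) refl x y z t E F)

  near-cong : E ≈ F → x ≈ z → y ≈ t → Near E x y → Near F z t
  near-cong E≈F x≈z y≈t (x≤ , y≤) = ≤-respˡ-≈ x≈z (≤-respʳ-≈ (+-cong y≈t E≈F) x≤)
                                  , ≤-respˡ-≈ y≈t (≤-respʳ-≈ (+-cong x≈z E≈F) y≤)

  near-weaken : E ≤ F → Near E x y → Near F x y
  near-weaken E≤F (x≤ , y≤) = ≤-trans x≤ (≤-refl ⊕ E≤F) , ≤-trans y≤ (≤-refl ⊕ E≤F)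

  near-∑ : ∀ N {f} → (∀ n → Near E (f n) y) → Near (fromℕ N * E) (∑ N f) (fromℕ N * y)
  near-∑ {E} {y} zero    near = near-cong (sym (zeroˡ E)) refl (sym (zeroˡ y))
    (≤-reflexive (sym (+-identityʳ 0#)) , ≤-reflexive (sym (+-identityʳ 0#)))
  near-∑ {E} {y} (suc N) near = near-cong (expand E)
      refl (expand y) (near-+ (near 0) (near-∑ N (near ∘ suc)))
    where
    expand : ∀ x → x + fromℕ N * x ≈ fromℕ (suc N) * x
    expand x = trans (+-congʳ (sym (*-identityˡ x))) (sym (distribʳ x 1# (fromℕ N)))

  -- `split` is Hermite's identity when the terms at 2n + 1 and 2n + 2 are, in either order, w(n)/2
  -- and w(n)/2 + ½. The bound `≤1` is not strict because 1 minus the van der Corput sequence starts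
  -- with 1.
  record Dyadic (w : ℕ → Carrier) : Set where
    field
      nonNegative : ∀ n → 0# ≤ w n
      ≤1          : ∀ n → w n ≤ 1#
      split       : ∀ t n → ⌊ t + w (suc (2 ℕ.* n)) ⌋ + ⌊ t + w (suc (suc
          (2 ℕ.* n))) ⌋ ≈ ⌊ t + t + w n ⌋

  module _ {w : ℕ → Carrier} (dyadic : Dyadic w) where

    open Dyadic dyadic

    near-⌊⌋ : ∀ t n → Near 1# ⌊ t + w n ⌋ t
    near-⌊⌋ t n = ≤-trans (⌊x⌋≤x (t + w n)) (≤-refl ⊕ ≤1 n)
      , ≤-trans (linear≤ (nonNegative n) (solve 2 (λ t w → con (+ 0) :+ (t :+ w) := w :+ t)
          refl t (w n))) (<⇒≤ (x<⌊x⌋+1 (t + w n)))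

    ∑-split : ∀ N t → ∑ (2 ℕ.* N) (λ n → ⌊ t + w (suc n) ⌋) ≈ ∑ N (λ n → ⌊ t + t + w n ⌋)
    ∑-split N t = trans (∑-pairs N (λ n → ⌊ t + w (suc n) ⌋)) (∑-cong N (split t))

    -- Splitting off one summand (two summands) for the digit 1 (for the
    -- digit 2) leaves the same sum for half as many terms at 2t.
    discrepancy : ∀ b t → Near (fromℕ (2 ℕ.* ℕᵇ.size b))
      (∑ (ℕᵇ.toℕ b) (λ n → ⌊ t + w n ⌋)) (fromℕ (ℕᵇ.toℕ b) * t)
    discrepancy zero t = near-cong refl refl (sym (zeroˡ t))
      (≤-reflexive (sym (+-identityʳ 0#)) , ≤-reflexive (sym (+-identityʳ 0#)))
    discrepancy 1+[2 b ] t = near-weaken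
      -- The unpaired term, at index 0, costs 1; the allowance of 2 per digit is set by the digit 2,
      -- which leaves one unpaired term at each end.
      (fromℕ-mono-≤ {suc (2 ℕ.* s)} (ℕ.≤-trans (ℕ.n≤1+n _) (ℕ.≤-reflexive (≡.sym (ℕ.*-suc 2 s)))))
      (near-cong refl (+-congˡ (sym (∑-split n t))) main (near-+ (near-⌊⌋ t 0) (discrepancy b
          (t + t))))
      where
      n = ℕᵇ.toℕ b
      s = ℕᵇ.size b
      main : t + fromℕ n * (t + t) ≈ fromℕ (suc (2 ℕ.* n)) * t
      main = begin-equality
        t + fromℕ n * (t + t)
            ≈⟨ +-cong (sym (*-identityˡ t)) (solve 2 (λ t n → n :* (t :+ t)
            := con (+ 2) :* n :* t) refl t (fromℕ n)) ⟩
        1# * t + fromℕ 2 * fromℕ n * t     ≈⟨ +-congˡ (*-congʳ (fromℕ-* 2 n)) ⟨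
        1# * t + fromℕ (2 ℕ.* n) * t       ≈⟨ distribʳ t 1# (fromℕ (2 ℕ.* n)) ⟨
        fromℕ (suc (2 ℕ.* n)) * t          ∎
        where open ≤-Reasoning
    discrepancy 2[1+ b ] t = ≡.subst₂ (λ K S → Near (fromℕ S) (∑ K (λ n → ⌊ t + w n ⌋))
        (fromℕ K * t))
      (≡.sym (ℕ.*-suc 2 n)) (≡.sym (ℕ.*-suc 2 s)) (near-cong
      (solve 2 (λ o s → o :+ s :+ o := o :+ (o :+ s)) refl 1# (fromℕ (2 ℕ.* s)))
      (trans (+-congʳ (+-congˡ (sym (∑-split n t)))) (sym (∑-last (suc (2 ℕ.* n)) (λ n →
          ⌊ t + w n ⌋)))) main
      (near-+ (near-+ (near-⌊⌋ t 0) (discrepancy b (t + t))) (near-⌊⌋ t (suc (2 ℕ.* n)))))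
      where
      n = ℕᵇ.toℕ b
      s = ℕᵇ.size b
      main : t + fromℕ n * (t + t) + t ≈ fromℕ (2 ℕ.+ 2 ℕ.* n) * t
      main = begin-equality
        t + fromℕ n * (t + t) + t
            ≈⟨ solve 2 (λ t n → t :+ n :* (t :+ t) :+ t := (con (+ 2) :+ con (+ 2) :* n) :* t)
            refl t (fromℕ n) ⟩
        (fromℕ 2 + fromℕ 2 * fromℕ n) * t           ≈⟨ *-congʳ (+-congˡ (fromℕ-* 2 n)) ⟨
        (fromℕ 2 + fromℕ (2 ℕ.* n)) * t             ≈⟨ *-congʳ (fromℕ-+ 2 (2 ℕ.* n)) ⟨
        fromℕ (2 ℕ.+ 2 ℕ.* n) * t                   ∎
        where open ≤-Reasoning

    ∑-⌊⌋-near : ∀ N t → Near (fromℕ (2 ℕ.* ℕᵇ.size (ℕᵇ.fromℕ N))) (∑ N (λ n → ⌊ t + w n ⌋))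
        (fromℕ N * t)
    ∑-⌊⌋-near N t = ≡.subst (λ M → Near (fromℕ (2 ℕ.* ℕᵇ.size (ℕᵇ.fromℕ N))) (∑ M (λ n →
        ⌊ t + w n ⌋)) (fromℕ M * t))
      (ℕᵇ.toℕ-fromℕ N) (discrepancy (ℕᵇ.fromℕ N) t)

-- The van der Corput sequence and its hits in a short window.

module VanDerCorput (ℝ : CompleteOrderedField) where

  open RealAnalysis ℝ
  open OrderedField ℝ
  open IntegerPart ℝ
  open Discrepancy ℝ

  vdcᵇ : ℕᵇ → Carrier
  vdcᵇ zero     = 0#
  vdcᵇ 1+[2 b ] = vdcᵇ b * ½
  vdcᵇ 2[1+ b ] = vdcᵇ b * ½ + ½

  -- A variant of the van der Corput sequence: n is written in bijective base-2
  -- numeration, with digits 1 and 2, which contribute 0 and ½ to the leading bit.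
  vdc : ℕ → Carrier
  vdc n = vdcᵇ (ℕᵇ.fromℕ n)

  vdcᵇ-nonNegative : ∀ b → 0# ≤ vdcᵇ b
  vdcᵇ-nonNegative zero     = ≤-refl
  vdcᵇ-nonNegative 1+[2 b ] = *-nonNegative (vdcᵇ-nonNegative b) (<⇒≤ 0<½)
  vdcᵇ-nonNegative 2[1+ b ] = ≤-respˡ-≈ (+-identityˡ 0#) (*-nonNegative (vdcᵇ-nonNegative b)
      (<⇒≤ 0<½) ⊕ <⇒≤ 0<½)

  ½<1 : ½ < 1#
  ½<1 = <-respˡ-≈ (+-identityˡ ½) (<-respʳ-≈ ½+½≈1 (0<½ <⊕ ≤-refl))

  vdcᵇ<1 : ∀ b → vdcᵇ b < 1#
  vdcᵇ<1 zero     = 0<1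
  vdcᵇ<1 1+[2 b ] = <-trans (<-respʳ-≈ (*-identityˡ ½) (*-monoʳ-< 0<½ (vdcᵇ<1 b))) ½<1
  vdcᵇ<1 2[1+ b ] = <-respʳ-≈ (trans (+-congʳ (*-identityˡ ½)) ½+½≈1) (*-monoʳ-< 0<½
      (vdcᵇ<1 b) <⊕ ≤-refl)

  fromℕ-odd : ∀ n → ℕᵇ.fromℕ (suc (2 ℕ.* n)) ≡ 1+[2 ℕᵇ.fromℕ n ]
  fromℕ-odd n = ℕᵇ.toℕ-injective {ℕᵇ.fromℕ (suc (2 ℕ.* n))} {1+[2 ℕᵇ.fromℕ n ]}
    (≡.trans (ℕᵇ.toℕ-fromℕ (suc (2 ℕ.* n))) (≡.cong (λ k → suc (2 ℕ.* k)) (≡.sym (ℕᵇ.toℕ-fromℕ n))))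

  fromℕ-even : ∀ n → ℕᵇ.fromℕ (suc (suc (2 ℕ.* n))) ≡ 2[1+ ℕᵇ.fromℕ n ]
  fromℕ-even n = ℕᵇ.toℕ-injective {ℕᵇ.fromℕ (suc (suc (2 ℕ.* n)))} {2[1+ ℕᵇ.fromℕ n ]}
    (≡.trans (ℕᵇ.toℕ-fromℕ (suc (suc (2 ℕ.* n))))
    (≡.trans (≡.sym (ℕ.*-suc 2 n)) (≡.cong (λ k → 2 ℕ.* suc k) (≡.sym (ℕᵇ.toℕ-fromℕ n)))))

  vdc-odd : ∀ n → vdc (suc (2 ℕ.* n)) ≡ vdc n * ½
  vdc-odd n = ≡.cong vdcᵇ (fromℕ-odd n)

  vdc-even : ∀ n → vdc (suc (suc (2 ℕ.* n))) ≡ vdc n * ½ + ½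
  vdc-even n = ≡.cong vdcᵇ (fromℕ-even n)

  twice-half : ∀ x → x * ½ + x * ½ ≈ x
  twice-half x = trans (sym (distribˡ x ½ ½)) (trans (*-congˡ ½+½≈1) (*-identityʳ x))

  vdc-dyadic : Dyadic vdc
  vdc-dyadic = record
    { nonNegative = λ n → vdcᵇ-nonNegative (ℕᵇ.fromℕ n)
    ; ≤1 = λ n → <⇒≤ (vdcᵇ<1 (ℕᵇ.fromℕ n))
    ; split = λ t n → begin-equality
        ⌊ t + vdc (suc (2 ℕ.* n)) ⌋ + ⌊ t + vdc (suc (suc (2 ℕ.* n))) ⌋
          ≡⟨ ≡.cong₂ (λ x y → ⌊ t + x ⌋ + ⌊ t + y ⌋) (vdc-odd n) (vdc-even n) ⟩
        ⌊ t + vdc n * ½ ⌋ + ⌊ t + (vdc n * ½ + ½) ⌋    ≈⟨ +-congˡ (⌊⌋-cong (+-assoc _ _ _)) ⟨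
        ⌊ t + vdc n * ½ ⌋ + ⌊ t + vdc n * ½ + ½ ⌋      ≈⟨ ⌊⌋-double (t + vdc n * ½) ⟩
        ⌊ t + vdc n * ½ + (t + vdc n * ½) ⌋
            ≈⟨ ⌊⌋-cong (solve 2 (λ t h → t :+ h :+ (t :+ h) := t :+ t :+ (h :+ h))
            refl t (vdc n * ½)) ⟩
        ⌊ t + t + (vdc n * ½ + vdc n * ½) ⌋            ≈⟨ ⌊⌋-cong (+-congˡ (twice-half (vdc n))) ⟩
        ⌊ t + t + vdc n ⌋                              ∎
    }
    where open ≤-Reasoning

  -- Reflection swaps the two halves of the unit interval and so preserves the dyadic structure. It
  -- serves the floor in which the sequence occurs with a minus sign.
  1-vdc-dyadic : Dyadic (λ n → 1# - vdc n)
  1-vdc-dyadic = record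
    { nonNegative = λ n → linear≤ (<⇒≤ (vdcᵇ<1 (ℕᵇ.fromℕ n))) (solve 2 (λ x o → x :+ (o :- x)
        := o :+ con (+ 0)) refl (vdc n) 1#)
    ; ≤1 = λ n → linear≤ (vdcᵇ-nonNegative (ℕᵇ.fromℕ n)) (solve 2 (λ x o → con (+ 0) :+ o
        := x :+ (o :- x)) refl (vdc n) 1#)
    ; split = λ t n → begin-equality
        ⌊ t + (1# - vdc (suc (2 ℕ.* n))) ⌋ + ⌊ t + (1# - vdc (suc (suc (2 ℕ.* n)))) ⌋
          ≡⟨ ≡.cong₂ (λ x y → ⌊ t + (1# - x) ⌋ + ⌊ t + (1# - y) ⌋) (vdc-odd n) (vdc-even n) ⟩
        ⌊ t + (1# - vdc n * ½) ⌋ + ⌊ t + (1# - (vdc n * ½ + ½)) ⌋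
          ≈⟨ +-cong (⌊⌋-cong (+-congˡ (+-congʳ (sym ½+½≈1)))) (⌊⌋-cong (+-congˡ (+-congʳ
              (sym ½+½≈1)))) ⟩
        ⌊ t + (½ + ½ - vdc n * ½) ⌋ + ⌊ t + (½ + ½ - (vdc n * ½ + ½)) ⌋
          ≈⟨ +-cong (⌊⌋-cong (solve 3 (λ t x h → t :+ (h :+ h :- x) := t :+ (h :- x) :+ h)
              refl t (vdc n * ½) ½))
                    (⌊⌋-cong (solve 3 (λ t x h → t :+ (h :+ h :- (x :+ h)) := t :+ (h :- x))
                        refl t (vdc n * ½) ½)) ⟩
        ⌊ t + (½ - vdc n * ½) + ½ ⌋ + ⌊ t + (½ - vdc n * ½) ⌋   ≈⟨ +-comm _ _ ⟩
        ⌊ t + (½ - vdc n * ½) ⌋ + ⌊ t + (½ - vdc n * ½) + ½ ⌋   ≈⟨ ⌊⌋-double (t + (½ - vdc n * ½)) ⟩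
        ⌊ t + (½ - vdc n * ½) + (t + (½ - vdc n * ½)) ⌋
            ≈⟨ ⌊⌋-cong (solve 3 (λ t x h → t :+ (h :- x) :+ (t :+ (h :- x))
            := t :+ t :+ (h :+ h :- (x :+ x))) refl t (vdc n * ½) ½) ⟩
        ⌊ t + t + (½ + ½ - (vdc n * ½ + vdc n * ½)) ⌋
            ≈⟨ ⌊⌋-cong (+-congˡ (+-cong ½+½≈1 (-‿cong (twice-half (vdc n))))) ⟩
        ⌊ t + t + (1# - vdc n) ⌋                                ∎
    }
    where open ≤-Reasoning

  error : ℕ → ℕ
  error N = 2 ℕ.* ℕᵇ.size (ℕᵇ.fromℕ N)

  -- The two floors have main terms N(ε - c) and N(ε + c), so the centre c cancels; each floor
  -- contributes one `error N`.
  ∑-hit-right : ∀ N ε c → Near (fromℕ (error N) + fromℕ (error N)) (∑ N (λ n → hit ε (vdc n - c)))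
      (fromℕ N * (ε + ε))
  ∑-hit-right N ε c = near-cong refl
    (trans (sym (∑-+ N (λ n → ⌊ ε - c + vdc n ⌋) (λ n → ⌊ ε + c + (1# - vdc n) ⌋))) (∑-cong N λ n →
        +-cong
      (⌊⌋-cong (solve 3 (λ ε c v → ε :- c :+ v := ε :+ (v :- c)) refl ε c (vdc n)))
      (⌊⌋-cong (solve 4 (λ ε c v o → ε :+ c :+ (o :- v) := ε :+ (o :- (v :- c)))
          refl ε c (vdc n) 1#))))
    (solve 3 (λ ε c n → n :* (ε :- c) :+ n :* (ε :+ c) := n :* (ε :+ ε)) refl ε c (fromℕ N))
    (near-+ (∑-⌊⌋-near vdc-dyadic N (ε - c)) (∑-⌊⌋-near 1-vdc-dyadic N (ε + c)))

  ∑-hit-left : ∀ N ε c → Near (fromℕ (error N) + fromℕ (error N)) (∑ N (λ n → hit ε (c - vdc n)))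
      (fromℕ N * (ε + ε))
  ∑-hit-left N ε c = near-cong refl
    (trans (sym (∑-+ N (λ n → ⌊ ε + c - 1# + (1# - vdc n) ⌋) (λ n → ⌊ ε - c + 1# + vdc n ⌋)))
        (∑-cong N λ n → +-cong
      -- Here the first floor carries the minus sign; the shifts by -1 and +1 put the terms in the
      -- forms 1 - v and v, and cancel in the main term.
      (⌊⌋-cong (solve 4 (λ ε c v o → ε :+ c :- o :+ (o :- v) := ε :+ (c :- v)) refl ε c (vdc n) 1#))
      (⌊⌋-cong (solve 4 (λ ε c v o → ε :- c :+ o :+ v := ε :+ (o :- (c :- v)))
          refl ε c (vdc n) 1#))))
    (solve 4 (λ ε c n o → n :* (ε :+ c :- o) :+ n :* (ε :- c :+ o) := n :* (ε :+ ε))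
        refl ε c (fromℕ N) 1#)
    (near-+ (∑-⌊⌋-near 1-vdc-dyadic N (ε + c - 1#)) (∑-⌊⌋-near vdc-dyadic N (ε - c + 1#)))

-- Cardinalities of filtered lists as sums of indicators.

module Counting (ℝ : CompleteOrderedField) where

  open RealAnalysis ℝ
  open OrderedField ℝ
  open Discrepancy ℝ using (∑; ∑-cong)

  private variable
    A B : Set

  ∑ˡ : List A → (A → Carrier) → Carrier
  ∑ˡ xs f = foldr (λ x s → f x + s) 0# xs

  ∑ˡ-++ : ∀ (xs ys : List A) f → ∑ˡ (xs ++ ys) f ≈ ∑ˡ xs f + ∑ˡ ys f
  ∑ˡ-++ []       ys f = sym (+-identityˡ _)
  ∑ˡ-++ (x ∷ xs) ys f = trans (+-congˡ (∑ˡ-++ xs ys f)) (sym (+-assoc _ _ _))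

  ∑ˡ-map : ∀ (g : A → B) xs f → ∑ˡ (map g xs) f ≡ ∑ˡ xs (f ∘ g)
  ∑ˡ-map g []       f = ≡.refl
  ∑ˡ-map g (x ∷ xs) f = ≡.cong (λ s → f (g x) + s) (∑ˡ-map g xs f)

  ∑ˡ-cartesianProduct : ∀ (xs : List A) (ys : List B) f →
    ∑ˡ (cartesianProduct xs ys) f ≈ ∑ˡ xs (λ x → ∑ˡ ys (λ y → f (x , y)))
  ∑ˡ-cartesianProduct []       ys f = refl
  ∑ˡ-cartesianProduct (x ∷ xs) ys f = trans (∑ˡ-++ (map (x ,_) ys) (cartesianProduct xs ys) f)
    (+-cong (reflexive (∑ˡ-map (x ,_) ys f)) (∑ˡ-cartesianProduct xs ys f))

  ∑ˡ-applyUpTo : ∀ N (g : ℕ → A) f → ∑ˡ (applyUpTo g N) f ≡ ∑ N (f ∘ g)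
  ∑ˡ-applyUpTo zero    g f = ≡.refl
  ∑ˡ-applyUpTo (suc N) g f = ≡.cong (λ s → f (g 0) + s) (∑ˡ-applyUpTo N (g ∘ suc) f)

  ∑ˡ-indices : ∀ N f → ∑ˡ (indices N) f ≡ ∑ N (f ∘ suc)
  ∑ˡ-indices N f = ≡.trans (∑ˡ-map suc (upTo N) f) (∑ˡ-applyUpTo N (λ n → n) (f ∘ suc))

  Indicates : (A → Carrier) → Pred A 0ℓ → Set
  Indicates f P = ∀ x → (P x × f x ≈ 1#) ⊎ (¬ P x × f x ≈ 0#)

  length-filter : ∀ {P : Pred A 0ℓ} (P? : Decidable P) {f} → Indicates f P →
    ∀ xs → fromℕ (length (filter P? xs)) ≈ ∑ˡ xs f
  length-filter P? indicates []       = refl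
  length-filter P? indicates (x ∷ xs) with P? x | indicates x
  ... | yes px | inj₁ (_   , fx≈1) = +-cong (sym fx≈1) (length-filter P? indicates xs)
  ... | yes px | inj₂ (¬px , _   ) = contradiction px ¬px
  ... | no ¬px | inj₁ (px  , _   ) = contradiction px ¬px
  ... | no ¬px | inj₂ (_   , fx≈0) = trans (sym (+-identityˡ _)) (+-cong (sym fx≈0)
      (length-filter P? indicates xs))

  length-filter-pairs : ∀ {P : Pred (ℕ × ℕ) 0ℓ} (P? : Decidable P) {f} → Indicates f P → ∀ N →
    fromℕ (length (filter P? (cartesianProduct (indices N) (indices N)))) ≈ ∑ N (λ m → ∑ N (λ n →
        f (suc m , suc n)))
  length-filter-pairs P? {f} indicates N = begin-equality
    fromℕ (length (filter P? (cartesianProduct I I)))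
        ≈⟨ length-filter P? indicates (cartesianProduct I I) ⟩
    ∑ˡ (cartesianProduct I I) f                          ≈⟨ ∑ˡ-cartesianProduct I I f ⟩
    ∑ˡ I (λ m → ∑ˡ I (λ n → f (m , n)))
        ≡⟨ ∑ˡ-indices N (λ m → ∑ˡ I (λ n → f (m , n))) ⟩
    ∑ N (λ m → ∑ˡ I (λ n → f (suc m , n)))
        ≈⟨ ∑-cong N (λ m → reflexive (∑ˡ-indices N (λ n → f (suc m , n)))) ⟩
    ∑ N (λ m → ∑ N (λ n → f (suc m , suc n)))            ∎
    where
    open ≤-Reasoning
    I = indices N

-- The collapsed sequence and its pair counts.

module CollapsedSequence (ℝ : CompleteOrderedField) where

  open RealAnalysis ℝ
  open OrderedField ℝ
  open IntegerPart ℝ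
  open Discrepancy ℝ
  open VanDerCorput ℝ
  open Counting ℝ

  collapse : Carrier → Carrier → Carrier
  collapse a z with z ≤? a
  ... | yes _ = 0#
  ... | no  _ = z

  -- Counting starts at index 1, hence the shift to `vdc n`; the value at 0 is a filler.
  collapsed : Carrier → ℕ → Carrier
  collapsed a zero    = 0#
  collapsed a (suc n) = collapse a (vdc n)

  module _ {a γ : Carrier} (0<a : 0# < a) (a+a≈γ : a + a ≈ γ) (4a≤1 : a + a + (a + a) ≤ 1#) where

    private
      x : ℕ → Carrier
      x = collapsed a
      0≤a = <⇒≤ 0<a
      2a≤γ = ≤-reflexive a+a≈γ
      γ≤2a = ≤-reflexive (sym a+a≈γ)

    module _ {ε : Carrier} (0≤ε : 0# ≤ ε) (ε<a : ε < a) where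

      -- Here u - v - γ lies in [-3a, -a], so ε < a and 4a ≤ 1 keep its ε-window strictly between -1
      -- and 0. The two floors are -1 and 1.
      hit-vanishes : ∀ {u v} → 0# ≤ u → u ≤ a → 0# ≤ v → v ≤ a → hit ε (u - v - γ) ≈ 0#
      hit-vanishes {u} {v} 0≤u u≤a 0≤v v≤a = trans (+-cong
        (⌊⌋-unique -[1+ 0 ] (-‿cong (sym (+-identityʳ 1#)))
          (linear≤ (0≤ε ⊕ 0≤u ⊕ v≤a ⊕ 4a≤1 ⊕ 0≤a ⊕ γ≤2a)
            (solve 6 (λ u v γ a ε o → con (+ 0) :+ (con (+ 0) :+ (v :+ (a :+ a :+ (a :+ a) :+ (con
                (+ 0) :+ γ)))) :+ (ε :+ (u :- v :- γ))
                                    := ε :+ (u :+ (a :+ (o :+ (a :+ (a :+ a))))) :+ (:- o))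
                                        refl u v γ a ε 1#))
          (linear< (ε<a <⊕ u≤a ⊕ 0≤v ⊕ 2a≤γ)
            (solve 6 (λ u v γ a ε o → ε :+ (u :+ (con (+ 0) :+ (a :+ a))) :+ (:- o :+ o)
                                    := a :+ (a :+ (v :+ γ)) :+ (ε :+ (u :- v :- γ)))
                                        refl u v γ a ε 1#)))
        (⌊⌋-unique (+ 1) (sym (+-identityʳ 1#))
          (linear≤ (0≤ε ⊕ u≤a ⊕ 0≤v ⊕ 2a≤γ ⊕ 0≤a)
            (solve 6 (λ u v γ a ε o → con (+ 0) :+ (u :+ (con (+ 0) :+ (a :+ a :+ con (+ 0)))) :+
                (ε :+ (o :- (u :- v :- γ)))
                                    := ε :+ (a :+ (v :+ (γ :+ a))) :+ o) refl u v γ a ε 1#))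
          (linear< (ε<a <⊕ 0≤u ⊕ v≤a ⊕ γ≤2a ⊕ 4a≤1)
            (solve 6 (λ u v γ a ε o → ε :+ (con (+ 0) :+ (v :+ (γ :+ (a :+ a :+ (a :+ a))))) :+
                (o :+ o)
                                    := a :+ (u :+ (a :+ (a :+ a :+ o))) :+ (ε :+ (o :-
                                        (u :- v :- γ)))) refl u v γ a ε 1#))))
        (solve 1 (λ o → :- o :+ o := con (+ 0)) refl 1#)

      -- Collapsing does not change the sum below: if u and v are not both in
      -- [0, a], then it does nothing to one of them, and otherwise γ = 2a is
      -- too far from all four differences.
      hit-exchange : ∀ {u v} → 0# ≤ u → 0# ≤ v →
        hit ε (collapse a u - collapse a v - γ) + hit ε (u - v - γ) ≈
        hit ε (u - collapse a v - γ) + hit ε (collapse a u - v - γ)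
      hit-exchange {u} {v} 0≤u 0≤v with u ≤? a | v ≤? a
      ... | no  _   | _       = refl
      ... | yes _   | no _    = +-comm _ _
      ... | yes u≤a | yes v≤a = +-cong
        (trans (hit-vanishes ≤-refl 0≤a ≤-refl 0≤a) (sym (hit-vanishes 0≤u u≤a ≤-refl 0≤a)))
        (trans (hit-vanishes 0≤u u≤a 0≤v v≤a) (sym (hit-vanishes ≤-refl 0≤a 0≤v v≤a)))

      hit-indicates : Indicates {A = ℕ × ℕ} (λ (m , n) → hit ε (x m - x n - γ)) (λ (m , n) → ¬
          (m ≡ n) × ‖ x m - x n - γ ‖ ≤ ε)
      hit-indicates (m , n) with hit-indicator (x m - x n - γ) 0≤ε
        (<-≤-trans (ε<a <⊕ <⇒≤ ε<a) (linear≤ (4a≤1 ⊕ 0≤a ⊕ 0≤a)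
            (solve 2 (λ a o → a :+ a :+ (a :+ a) :+ (con (+ 0) :+ con (+ 0)) :+ o
            := o :+ (a :+ a) :+ (a :+ a)) refl a 1#)))
      ... | inj₂ (ε<‖‖ , hit≈0) = inj₂ ((λ (_ , ‖‖≤ε) → <⇒≱ ε<‖‖ ‖‖≤ε) , hit≈0)
      ... | inj₁ (‖‖≤ε , hit≈1) = inj₁ ((m≢n , ‖‖≤ε) , hit≈1)
        where
        -- On the diagonal the argument is -γ, the case u = v = 0 of `hit-vanishes`.
        m≢n : ¬ (m ≡ n)
        m≢n ≡.refl = 0≉1 (trans (sym (hit-vanishes ≤-refl 0≤a ≤-refl 0≤a))
          (trans (hit-cong ε (solve 2 (λ x γ → con (+ 0) :- con (+ 0) :- γ := x :- x :- γ)
              refl (x m) γ)) hit≈1))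

      hits : (ℕ → Carrier) → (ℕ → Carrier) → ℕ → Carrier
      hits y z N = ∑ N (λ m → ∑ N (λ n → hit ε (y m - z n - γ)))

      -- Each row m is a window count for the van der Corput sequence centred at y(m) - γ, whatever
      -- y is.
      hits-vdc-left : ∀ (y : ℕ → Carrier) N → Near (fromℕ N * (fromℕ (error N) + fromℕ (error N)))
          (hits y vdc N) (fromℕ N * (fromℕ N * (ε + ε)))
      hits-vdc-left y N = near-∑ N {λ m → ∑ N (λ n → hit ε (y m - vdc n - γ))} λ m → near-cong refl
        (∑-cong N λ n → hit-cong ε (solve 3 (λ y v γ → y :- γ :- v := y :- v :- γ)
            refl (y m) (vdc n) γ)) refl
        (∑-hit-left N ε (y m - γ))

      hits-vdc-right : ∀ (z : ℕ → Carrier) N → Near (fromℕ N * (fromℕ (error N) + fromℕ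
          (error N))) (hits vdc z N) (fromℕ N * (fromℕ N * (ε + ε)))
      hits-vdc-right z N = near-cong refl (sym (∑-swap N N (λ m n → hit ε (vdc m - z n - γ)))) refl
        (near-∑ N {λ n → ∑ N (λ m → hit ε (vdc m - z n - γ))} λ n → near-cong refl
          (∑-cong N λ m → hit-cong ε (solve 3 (λ z v γ → v :- (z :+ γ) := v :- z :- γ)
              refl (z n) (vdc m) γ)) refl
          (∑-hit-right N ε (z n + γ)))

      hits-collapsed : ∀ N → hits (x ∘ suc) (x ∘ suc) N + hits vdc vdc N ≈ hits vdc
          (x ∘ suc) N + hits (x ∘ suc) vdc N
      hits-collapsed N = begin-equality
        hits x′ x′ N + hits vdc vdc N
          ≈⟨ ∑∑-+ (λ m n → hit ε (x′ m - x′ n - γ)) (λ m n → hit ε (vdc m - vdc n - γ)) ⟨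
        ∑ N (λ m → ∑ N (λ n → hit ε (x′ m - x′ n - γ) + hit ε (vdc m - vdc n - γ)))
          ≈⟨ ∑-cong N (λ m → ∑-cong N (λ n → hit-exchange (Dyadic.nonNegative vdc-dyadic m)
              (Dyadic.nonNegative vdc-dyadic n))) ⟩
        ∑ N (λ m → ∑ N (λ n → hit ε (vdc m - x′ n - γ) + hit ε (x′ m - vdc n - γ)))
          ≈⟨ ∑∑-+ (λ m n → hit ε (vdc m - x′ n - γ)) (λ m n → hit ε (x′ m - vdc n - γ)) ⟩
        hits vdc x′ N + hits x′ vdc N ∎
        where
        open ≤-Reasoning
        x′ : ℕ → Carrier
        x′ = x ∘ suc
        ∑∑-+ : ∀ (f g : ℕ → ℕ → Carrier) → ∑ N (λ m → ∑ N (λ n → f m n + g m n)) ≈ ∑ N (λ m → ∑ N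
            (f m)) + ∑ N (λ m → ∑ N (g m))
        ∑∑-+ f g = trans (∑-cong N (λ m → ∑-+ N (f m) (g m))) (∑-+ N (λ m → ∑ N (f m)) (λ m → ∑ N
            (g m)))

      -- p = r + s - q, and the three errors add up.
      near-exchange : ∀ {E p q r s t} → p + q ≈ r + s → Near E q t → Near E r t → Near E s t →
          Near (E + E + E) p t
      near-exchange {E} {p} {q} {r} {s} {t} eq (q≤ , t≤q) (r≤ , t≤r) (s≤ , t≤s) =
          linear≤ (≤-reflexive eq ⊕ t≤q ⊕ r≤ ⊕ s≤)
              (solve 6 (λ p q r s t e → p :+ q :+ (t :+ (r :+ s)) :+ (t :+ (e :+ e :+ e))
                                                  := r :+ s :+ (q :+ e :+ (t :+ e :+
                                                      (t :+ e))) :+ p) refl p q r s t E)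
        , linear≤ (≤-reflexive (sym eq) ⊕ q≤ ⊕ t≤r ⊕ t≤s)
            (solve 6 (λ p q r s t e → r :+ s :+ (q :+ (t :+ t)) :+ (p :+ (e :+ e :+ e))
                                                  := p :+ q :+ (t :+ e :+ (r :+ e :+
                                                      (s :+ e))) :+ t) refl p q r s t E)

      -- The constant 12 is three double sums, times two floors per indicator, times an error of two
      -- per binary digit.
      hits-near : ∀ N → Near (fromℕ 12 * (fromℕ (BinarySize.binarySize N) * fromℕ N)) (hits
          (x ∘ suc) (x ∘ suc) N) (fromℕ N * (fromℕ N * (ε + ε)))
      hits-near N = near-cong (trans (+-cong (+-cong F≈ F≈) F≈)
          (solve 2 (λ n s → n :* (con (+ 4) :* s) :+ n :* (con (+ 4) :* s) :+ n :* (con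
          (+ 4) :* s) := con (+ 12) :* (s :* n)) refl (fromℕ N) S)) refl refl
        (near-exchange (hits-collapsed N) (hits-vdc-left vdc N) (hits-vdc-right (x ∘ suc) N)
            (hits-vdc-left (x ∘ suc) N))
        where
        s = BinarySize.binarySize N
        S = fromℕ s
        F≈ : fromℕ N * (fromℕ (error N) + fromℕ (error N)) ≈ fromℕ N * (fromℕ 4 * S)
        F≈ = *-congˡ (trans (+-cong (fromℕ-* 2 s) (fromℕ-* 2 s))
            (solve 1 (λ s → con (+ 2) :* s :+ con (+ 2) :* s := con (+ 4) :* s) refl S))

-- Failure of equidistribution.

module NotEquidistributed (ℝ : CompleteOrderedField) where

  open RealAnalysis ℝ
  open OrderedField ℝ
  open IntegerPart ℝ
  open VanDerCorput ℝ
  open CollapsedSequence ℝ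

  private variable
    x : Carrier

  mod1-identity : 0# ≤ x → x < 1# → x mod1 ≈ x
  mod1-identity {x} 0≤x x<1 = trans
    (+-congˡ (-‿cong (⌊⌋-unique (+ 0) refl 0≤x (<-respʳ-≈ (sym (+-identityˡ 1#)) x<1))))
    (trans (+-congˡ -0#≈0#) (+-identityʳ x))

  collapsed-avoids : ∀ {a b} → 0# < b → ∀ n → ¬ (b ≤ collapsed a n mod1 × collapsed a n mod1 ≤ a)
  collapsed-avoids {a} {b} 0<b zero    = λ (b≤ , _) → <⇒≱ 0<b (≤-respʳ-≈
      (mod1-identity ≤-refl 0<1) b≤)
  collapsed-avoids {a} {b} 0<b (suc n) with vdc n ≤? a
  ... | yes _    = λ (b≤ , _) → <⇒≱ 0<b (≤-respʳ-≈ (mod1-identity ≤-refl 0<1) b≤)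
  ... | no v≰a = λ (_ , ≤a) → v≰a (≤-respˡ-≈
    (mod1-identity (vdcᵇ-nonNegative (ℕᵇ.fromℕ n)) (vdcᵇ<1 (ℕᵇ.fromℕ n))) ≤a)

  collapsed-not-equidistributed : ∀ {a} → 0# < a → a < 1# → ¬ Equidistributed (collapsed a)
  collapsed-not-equidistributed {a} 0<a a<1 equidistributed =
    <⇒≱ (close N₀ ℕ.≤-refl) (≤-trans (≤-reflexive a/2≈) (x≤y⊔x _ _))
    where
    a/2 = a * ½
    0<a/2 : 0# < a/2
    0<a/2 = *-positive 0<a 0<½
    a/2≤a : a/2 ≤ a
    a/2≤a = linear≤ (<⇒≤ 0<a/2) (trans (+-identityˡ a) (sym (twice-half a)))
    -- The tolerance equals the length of the interval, so a visit ratio of 0 already violates the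
    -- strict bound.
    tends = equidistributed a/2 a (<⇒≤ 0<a/2) a/2≤a a<1 a/2 0<a/2
    N₀ = proj₁ tends
    close = proj₂ tends
    no-visits : visitCount a/2 a (collapsed a) N₀ ≡ 0
    no-visits = ≡.cong length (List.filter-none _ (All.universal (collapsed-avoids 0<a/2)
        (indices N₀)))
    -- With no visits the quotient is 0 whatever the inverse of N₀ is, so N₀ = 0 is covered.
    a/2≈ : a/2 ≈ - (fromℕ (visitCount a/2 a (collapsed a) N₀) / fromℕ N₀ - (a - a/2))
    a/2≈ = begin-equality
      a/2
          ≈⟨ solve 2 (λ h z → h := :- (con (+ 0) :* z :- (h :+ h :- h))) refl a/2 (fromℕ N₀ ⁻¹) ⟩
      - (0# / fromℕ N₀ - (a/2 + a/2 - a/2))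
          ≈⟨ -‿cong (+-congˡ (-‿cong (+-congʳ (twice-half a)))) ⟩
      - (0# / fromℕ N₀ - (a - a/2))
          ≡⟨ ≡.cong (λ v → - (fromℕ v / fromℕ N₀ - (a - a/2))) no-visits ⟨
      - (fromℕ (visitCount a/2 a (collapsed a) N₀) / fromℕ N₀ - (a - a/2)) ∎
      where open ≤-Reasoning

-- Growth comparisons and the limit of the pair count.

module PairCorrelation (ℝ : CompleteOrderedField) where

  open RealAnalysis ℝ
  open OrderedField ℝ
  open IntegerPart ℝ
  open RealPower ℝ
  open Discrepancy ℝ using (Near; near-cong)
  open CollapsedSequence ℝ
  open Counting ℝ using (length-filter-pairs)
  open BinarySize using (binarySize; [K*binarySize]^q<N)

  private variable
    a e γ δ s : Carrier

  -- Provides a rational exponent 1/q below a positive real one, to which `b^p≤[b^ʳe]^q` applies.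
  reciprocal-bound : 0# < e → ∃[ r ] 1# ≤ e * fromℕ (suc r)
  reciprocal-bound {e} 0<e = r , (begin
    1#                  ≤⟨ x/z≤y⇒x≤yz 0<e (proj₂ (archimedean (1# / e))) ⟩
    fromℕ r * e         ≤⟨ *-monoʳ-≤ (<⇒≤ 0<e) (fromℕ-mono-≤ (ℕ.n≤1+n r)) ⟩
    fromℕ (suc r) * e   ≈⟨ *-comm _ _ ⟩
    e * fromℕ (suc r)   ∎)
    where
    open ≤-Reasoning
    r = proj₁ (archimedean (1# / e))

  -- For 1/q ≤ δ it suffices that N^(1/q) exceeds K, that is, N > K^q.
  ^ʳ-unbounded : 0# < δ → ∀ K → ∃[ N₀ ] ∀ N → N₀ ℕ.≤ N → fromℕ K < fromℕ N ^ʳ δ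
  ^ʳ-unbounded {δ} 0<δ K = suc (K ℕ.^ q) , λ N K^q<N → ^-cancel-< q
    (≤-trans 0≤1 (1≤^ʳ (1≤N K^q<N) (<⇒≤ 0<δ)))
    (begin-strict
      fromℕ K ^ q          ≈⟨ fromℕ-^ K q ⟨
      fromℕ (K ℕ.^ q)      <⟨ fromℕ-mono-< K^q<N ⟩
      fromℕ N              ≈⟨ *-identityʳ _ ⟨
      fromℕ N ^ 1
          ≤⟨ b^p≤[b^ʳe]^q (1≤N K^q<N) 1 r (x/z≤y (fromℕ-suc-positive r) (≤-respˡ-≈ (sym
          (+-identityʳ 1#)) 1≤δq)) ⟩
      (fromℕ N ^ʳ δ) ^ q   ∎)
    where
    open ≤-Reasoning
    r = proj₁ (reciprocal-bound 0<δ)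
    1≤δq = proj₂ (reciprocal-bound 0<δ)
    q = suc r
    1≤N : ∀ {N} → suc (K ℕ.^ q) ℕ.≤ N → 1# ≤ fromℕ N
    1≤N {N} K^q<N = 1≤fromℕ {N} (ℕ.≤-trans (s≤s z≤n) K^q<N)

  module _ (δ<1 : δ < 1#) where

    0<1-δ : 0# < 1# - δ
    0<1-δ = linear< δ<1 (solve 2 (λ δ o → δ :+ (o :- δ) := o :+ con (+ 0)) refl δ 1#)

    0≤2-δ : 0# ≤ fromℕ 2 - δ
    0≤2-δ = linear≤ (<⇒≤ 0<1-δ ⊕ 0≤1)
        (solve 2 (λ δ o → con (+ 0) :+ con (+ 0) :+ (o :+ (o :+ con (+ 0)) :- δ)
        := o :- δ :+ o :+ con (+ 0)) refl δ 1#)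

    -- Choosing 1/q ≤ 1 - δ gives (q + 1)/q ≤ 2 - δ, and comparing q-th powers leaves a power of the
    -- digit count against a single factor N.
    K*binarySize*N<N^[2-δ] : ∀ K → ∃[ N₀ ] ∀ N → N₀ ℕ.≤ N →
      fromℕ (K ℕ.* binarySize N ℕ.* N) < fromℕ N ^ʳ (fromℕ 2 - δ)
    K*binarySize*N<N^[2-δ] K = suc N₀ , λ N N₀<N → ^-cancel-< q
      (≤-trans 0≤1 (1≤^ʳ (1≤N N₀<N) 0≤2-δ))
      (begin-strict
        fromℕ (K ℕ.* binarySize N ℕ.* N) ^ q              ≈⟨ fromℕ-^ (K ℕ.* binarySize N ℕ.* N) q ⟨
        fromℕ ((K ℕ.* binarySize N ℕ.* N) ℕ.^ q)
            ≡⟨ ≡.cong fromℕ (BinarySize.*-distrib-^ (K ℕ.* binarySize N) N q) ⟩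
        fromℕ ((K ℕ.* binarySize N) ℕ.^ q ℕ.* N ℕ.^ q)
            <⟨ fromℕ-mono-< (ℕ.*-monoˡ-< (N ℕ.^ q) {{ℕ.m^n≢0 N q {{ℕ.>-nonZero (ℕ.≤-trans
            (s≤s z≤n) N₀<N)}}}} (below N (ℕ.<⇒≤ N₀<N))) ⟩
        fromℕ (N ℕ.^ suc q)                               ≈⟨ fromℕ-^ N (suc q) ⟩
        fromℕ N ^ suc q
            ≤⟨ b^p≤[b^ʳe]^q (1≤N N₀<N) (suc q) r (x/z≤y (fromℕ-suc-positive r) p≤[2-δ]q) ⟩
        (fromℕ N ^ʳ (fromℕ 2 - δ)) ^ q                    ∎)
      where
      open ≤-Reasoning
      r = proj₁ (reciprocal-bound 0<1-δ)
      1≤[1-δ]q = proj₂ (reciprocal-bound 0<1-δ)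
      q = suc r
      N₀ = proj₁ ([K*binarySize]^q<N K q)
      below = proj₂ ([K*binarySize]^q<N K q)
      1≤N : ∀ {N} → suc N₀ ℕ.≤ N → 1# ≤ fromℕ N
      1≤N {N} N₀<N = 1≤fromℕ {N} (ℕ.≤-trans (s≤s z≤n) N₀<N)
      p≤[2-δ]q : fromℕ (suc q) ≤ (fromℕ 2 - δ) * fromℕ q
      p≤[2-δ]q = linear≤ (≤-respʳ-≈ (trans (distribʳ _ _ _) (+-congʳ (*-identityˡ _))) 1≤[1-δ]q)
        (solve 3 (λ o δ q → o :+ (con (+ 2) :- δ) :* q := q :+ :- δ :* q :+ (o :+ q))
            refl 1# δ (fromℕ q))

  scaled-near : ∀ {w E p l η} → 0# < w → Near E p (l * w) → E < η * w → ∣ 1# / w * p - l ∣ < η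
  scaled-near {w} {E} {p} {l} {η} 0<w (p≤ , ≤p) E<ηw = ∣x∣<y
    (linear< l<y+η (solve 3 (λ l y η → l :+ (y :- l) := y :+ η :+ :- η) refl l y η))
    (linear< y<l+η (solve 3 (λ l y η → y :+ η := l :+ η :+ (y :- l)) refl l y η))
    where
    open ≤-Reasoning
    y = 1# / w * p
    yw≈p : y * w ≈ p
    yw≈p = begin-equality
      1# / w * p * w
          ≈⟨ solve 4 (λ o v p w → o :* v :* p :* w := o :* v :* w :* p) refl 1# (w ⁻¹) p w ⟩
      1# / w * w * p      ≈⟨ *-congʳ (/-*-cancel 0<w) ⟩
      1# * p              ≈⟨ *-identityˡ p ⟩
      p                   ∎
    l<y+η : l < y + η
    l<y+η = *-cancelʳ-< (<⇒≤ 0<w) (begin-strict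
      l * w            ≤⟨ ≤p ⟩
      p + E            <⟨ ≤-refl ⊕< E<ηw ⟩
      p + η * w        ≈⟨ +-congʳ yw≈p ⟨
      y * w + η * w    ≈⟨ distribʳ w y η ⟨
      (y + η) * w      ∎)
    y<l+η : y < l + η
    y<l+η = *-cancelʳ-< (<⇒≤ 0<w) (begin-strict
      y * w            ≈⟨ yw≈p ⟩
      p                ≤⟨ p≤ ⟩
      l * w + E        <⟨ ≤-refl ⊕< E<ηw ⟩
      l * w + η * w    ≈⟨ distribʳ w l η ⟨
      (l + η) * w      ∎)

  collapsed-weakPPC : 0# < a → a + a ≈ γ → a + a + (a + a) ≤ 1# → 0# < δ → δ < 1# → WeakPPC γ δ
      (collapsed a)
  collapsed-weakPPC {a} {γ} {δ} 0<a a+a≈γ 4a≤1 0<δ δ<1 s 0<s η 0<η =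
    suc (proj₁ u-large ℕ.+ proj₁ w-large) , close
    where
    open ≤-Reasoning
    K L : ℕ
    -- N^δ > `K` ≥ s/a makes ε < a, and `L` ≥ 12/η brings the error below η * N^(2-δ).
    K = proj₁ (archimedean (s / a))
    L = proj₁ (archimedean (fromℕ 12 / η))
    u-large = ^ʳ-unbounded 0<δ K
    w-large = K*binarySize*N<N^[2-δ] δ<1 L
    close : ∀ N → suc (proj₁ u-large ℕ.+ proj₁ w-large) ℕ.≤ N →
      ∣ 1# / fromℕ N ^ʳ (fromℕ 2 - δ) * fromℕ (pairCount γ δ s (collapsed a) N) - fromℕ 2 * s ∣ < η
    close N N₀<N = scaled-near 0<w (near-cong refl (sym count) main-term
        (hits-near 0<a a+a≈γ 4a≤1 0≤ε ε<a N)) error<ηw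
      where
      1≤N : 1# ≤ fromℕ N
      1≤N = 1≤fromℕ {N} (ℕ.≤-trans (s≤s z≤n) N₀<N)
      S : ℕ
      S = binarySize N
      u w ε : Carrier
      u = fromℕ N ^ʳ δ
      w = fromℕ N ^ʳ (fromℕ 2 - δ)
      ε = s / u
      0<u : 0# < u
      0<u = ^ʳ-positive 1≤N (<⇒≤ 0<δ)
      0<w : 0# < w
      0<w = ^ʳ-positive 1≤N (0≤2-δ δ<1)
      K<u : fromℕ K < u
      K<u = proj₂ u-large N (ℕ.≤-trans (ℕ.m≤m+n (proj₁ u-large) (proj₁ w-large)) (ℕ.<⇒≤ N₀<N))
      LSN<w : fromℕ (L ℕ.* S ℕ.* N) < w
      LSN<w = proj₂ w-large N (ℕ.≤-trans (ℕ.m≤n+m (proj₁ w-large) (proj₁ u-large)) (ℕ.<⇒≤ N₀<N))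
      0≤ε : 0# ≤ ε
      0≤ε = <⇒≤ (/-positive 0<s 0<u)
      ε<a : ε < a
      ε<a = x/z<y 0<u (begin-strict
        s              ≤⟨ x/z≤y⇒x≤yz 0<a (proj₂ (archimedean (s / a))) ⟩
        fromℕ K * a    <⟨ *-monoʳ-< 0<a K<u ⟩
        u * a          ≈⟨ *-comm u a ⟩
        a * u          ∎)
      count : fromℕ (pairCount γ δ s (collapsed a) N) ≈ hits 0<a a+a≈γ 4a≤1 0≤ε ε<a
          (collapsed a ∘ suc) (collapsed a ∘ suc) N
      count = length-filter-pairs _ (hit-indicates 0<a a+a≈γ 4a≤1 0≤ε ε<a) N
      main-term : fromℕ N * (fromℕ N * (ε + ε)) ≈ fromℕ 2 * s * w
      -- One factor N^δ of N² cancels the denominator of ε = s/N^δ and leaves 2s * N^(2-δ).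
      main-term = begin-equality
        fromℕ N * (fromℕ N * (ε + ε))
            ≈⟨ solve 2 (λ n ε → n :* (n :* (ε :+ ε)) := con (+ 2) :* ε :* (n :* n))
            refl (fromℕ N) ε ⟩
        fromℕ 2 * ε * (fromℕ N * fromℕ N)   ≈⟨ *-congˡ (*-congˡ (*-identityʳ (fromℕ N))) ⟨
        fromℕ 2 * ε * fromℕ N ^ 2
            ≈⟨ *-congˡ (^ʳ-* 1≤N (<⇒≤ 0<δ) (0≤2-δ δ<1) 2 (solve 1 (λ d → d :+ (con (+ 2) :- d)
            := con (+ 2)) refl δ)) ⟨
        fromℕ 2 * ε * (u * w)
            ≈⟨ solve 4 (λ t ε u w → t :* ε :* (u :* w) := t :* (ε :* u) :* w) refl (fromℕ 2) ε u w ⟩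
        fromℕ 2 * (ε * u) * w               ≈⟨ *-congʳ (*-congˡ (/-*-cancel 0<u)) ⟩
        fromℕ 2 * s * w                     ∎
      error<ηw : fromℕ 12 * (fromℕ S * fromℕ N) < η * w
      error<ηw = begin-strict
        fromℕ 12 * (fromℕ S * fromℕ N)
            ≤⟨ *-monoʳ-≤ (*-nonNegative (fromℕ-nonNegative S) (fromℕ-nonNegative N))
            (x/z≤y⇒x≤yz 0<η (proj₂ (archimedean (fromℕ 12 / η)))) ⟩
        fromℕ L * η * (fromℕ S * fromℕ N)
            ≈⟨ solve 4 (λ l e s n → l :* e :* (s :* n) := l :* s :* n :* e)
            refl (fromℕ L) η (fromℕ S) (fromℕ N) ⟩
        fromℕ L * fromℕ S * fromℕ N * η       ≈⟨ *-congʳ (*-congʳ (fromℕ-* L S)) ⟨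
        fromℕ (L ℕ.* S) * fromℕ N * η         ≈⟨ *-congʳ (fromℕ-* (L ℕ.* S) N) ⟨
        fromℕ (L ℕ.* S ℕ.* N) * η             <⟨ *-monoʳ-< 0<η LSN<w ⟩
        w * η                                 ≈⟨ *-comm w η ⟩
        η * w                                 ∎

theorem1p2 : (ℝ : CompleteOrderedField) → let open RealAnalysis ℝ in
    ∀ (γ δ : Carrier) → 0# < γ → γ ≤ 1# / fromℕ 2 → 0# < δ → δ < 1# →
    ∃[ x ] (WeakPPC γ δ x × ¬ Equidistributed x)
theorem1p2 ℝ γ δ 0<γ γ≤½ 0<δ δ<1 =
  collapsed a , collapsed-weakPPC 0<a
      (twice-half γ) 4a≤1 0<δ δ<1 , collapsed-not-equidistributed 0<a a<1
  where
  open RealAnalysis ℝ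
  open OrderedField ℝ
  open IntegerPart ℝ
  open VanDerCorput ℝ
  open CollapsedSequence ℝ
  open NotEquidistributed ℝ
  open PairCorrelation ℝ
  a : Carrier
  a = γ * ½
  0<a : 0# < a
  0<a = *-positive 0<γ 0<½
  -- Since 4a = 2γ, this is the hypothesis γ ≤ ½.
  4a≤1 : a + a + (a + a) ≤ 1#
  4a≤1 = ≤-respˡ-≈ (+-cong (sym (twice-half γ)) (sym (twice-half γ))) (≤-respʳ-≈ ½+½≈1 (γ≤½ ⊕ γ≤½))
  a<1 : a < 1#
  a<1 = linear< (0<a <⊕ <⇒≤ 0<a ⊕ <⇒≤ 0<a ⊕ 4a≤1)
    (solve 2 (λ a o → con (+ 0) :+ (con (+ 0) :+ (con (+ 0) :+ (a :+ a :+ (a :+ a)))) :+ o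
        := a :+ (a :+ (a :+ o)) :+ a) refl a 1#)
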